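{- $$\prod_{n=1}^{\infty}\begin{pmatrix}\frac{n}{2(2n+1)} & \frac{ -3}{2n(2n+1)} & \frac{3}{2n^{3}}\\ 0 & \frac{n}{2(2n+1)} & \frac{3}{2n}\\ 0 & 0 & 1\end{pmatrix}=\begin{pmatrix}0 & 0 & \zeta(4)\\ 0 & 0 & \zeta(2)\\ 0 & 0 & 1\end{pmatrix}.$$
   Context: $\zeta(s)=\sum_{n\geqslant1}n^{ -s}$ is the Riemann zeta function. The infinite product $\prod_{n=1}^\infty \mathbf{M}_n$ of square matrices means the entrywise limit as $m\to\infty$ of the ordered products $\mathbf{M}_1\mathbf{M}_2\cdots\mathbf{M}_m$ (factors multiplied from left to right in increasing index). -}

module Defs where

open import Data.Nat.Base as ℕ using (ℕ; zero; suc; s≤s; z≤n)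
import Data.Nat.Properties as ℕ
import Data.Nat.Tactic.RingSolver as ℕ-Solver
open import Data.Integer.Base as ℤ using (+_; -[1+_]; +[1+_]; +0)
import Data.Integer.Properties as ℤ
open import Data.Rational.Base as ℚ using (ℚ; 0ℚ; 1ℚ; ½; _/_; mkℚ; toℚᵘ)
import Data.Rational.Properties as ℚ
import Data.Rational.Unnormalised.Base as ℚᵘ
import Data.Rational.Unnormalised.Properties as ℚᵘ
open import Data.Fin.Base using (Fin)
import Data.Fin.Properties as Fin
open import Data.Vec.Functional using (Vector; []; _∷_)
open import Data.Product.Base using (Σ-syntax; ∃-syntax; _×_; _,_)
open import Data.Sum.Base using (inj₁; inj₂)
open import Data.Bool.Base using (if_then_else_)
open import Function.Base using (_∘_)
open import Relation.Nullary.Decidable.Core using (does)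
open import Relation.Binary.PropositionalEquality
  using (_≡_; sym; trans; cong; subst; subst₂)
open import Algebra.Bundles using (CommutativeMonoid)
open import Algebra.Definitions.RawMonoid ℚ.+-0-rawMonoid using (sum)
open import Algebra.Properties.Group ℚ.+-0-group using (⁻¹-anti-homo-∙; ⁻¹-involutive)
open import Algebra.Properties.AbelianGroup ℚ.+-0-abelianGroup using (⁻¹-∙-comm)
open import Algebra.Properties.CommutativeSemigroup
  (CommutativeMonoid.commutativeSemigroup ℚ.+-0-commutativeMonoid) using (interchange)

------------------------------------------------------------------------
-- Real numbers as Cauchy sequences of rationals.  The witness N in
-- IsCauchy is a modulus of convergence.

IsCauchy : (ℕ → ℚ) → Set
IsCauchy x = (ε : ℚ) → 0ℚ ℚ.< ε →
  ∃[ N ] ((m n : ℕ) → N ℕ.≤ m → N ℕ.≤ n → ℚ.∣ x m ℚ.- x n ∣ ℚ.< ε)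

record ℝ : Set where
  constructor mkℝ
  field
    seq    : ℕ → ℚ
    cauchy : IsCauchy seq

open ℝ public

private
  halve : ∀ ε → ½ ℚ.* ε ℚ.+ ½ ℚ.* ε ≡ ε
  halve ε = trans (sym (ℚ.*-distribʳ-+ ε ½ ½)) (ℚ.*-identityˡ ε)

  half-pos : ∀ {ε} → 0ℚ ℚ.< ε → 0ℚ ℚ.< ½ ℚ.* ε
  half-pos {ε} 0<ε = subst (ℚ._< ½ ℚ.* ε) (ℚ.*-zeroʳ ½) (ℚ.*-monoʳ-<-pos ½ 0<ε)

  sub-interchange : ∀ a b c d →
    (a ℚ.- b) ℚ.- (c ℚ.- d) ≡ (a ℚ.- c) ℚ.- (b ℚ.- d)
  sub-interchange a b c d = trans
    (cong ((a ℚ.- b) ℚ.+_) (sym (⁻¹-∙-comm c (ℚ.- d))))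
    (trans (interchange a (ℚ.- b) (ℚ.- c) (ℚ.- (ℚ.- d)))
           (cong ((a ℚ.- c) ℚ.+_) (⁻¹-∙-comm b (ℚ.- d))))

  sub-add : ∀ a b → (a ℚ.- b) ℚ.+ b ≡ a
  sub-add a b = trans (ℚ.+-assoc a (ℚ.- b) b)
    (trans (cong (a ℚ.+_) (ℚ.+-inverseˡ b)) (ℚ.+-identityʳ a))

  neg-sub : ∀ a b → ℚ.- (a ℚ.- b) ≡ b ℚ.- a
  neg-sub a b = trans (⁻¹-anti-homo-∙ a (ℚ.- b))
    (cong (ℚ._- a) (⁻¹-involutive b))

  abs-sub-comm : ∀ a b → ℚ.∣ a ℚ.- b ∣ ≡ ℚ.∣ b ℚ.- a ∣
  abs-sub-comm a b = trans (sym (ℚ.∣-p∣≡∣p∣ (a ℚ.- b))) (cong ℚ.∣_∣ (neg-sub a b))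

  ≤-add⇒sub-≤ : ∀ a b c → a ℚ.≤ c ℚ.+ b → a ℚ.- b ℚ.≤ c
  ≤-add⇒sub-≤ a b c h = subst (a ℚ.- b ℚ.≤_)
    (trans (ℚ.+-assoc c b (ℚ.- b))
      (trans (cong (c ℚ.+_) (ℚ.+-inverseʳ b)) (ℚ.+-identityʳ c)))
    (ℚ.+-monoˡ-≤ (ℚ.- b) h)

  abs-≤ : ∀ {p c} → p ℚ.≤ c → ℚ.- p ℚ.≤ c → ℚ.∣ p ∣ ℚ.≤ c
  abs-≤ {p} h₁ h₂ with ℚ.∣p∣≡p∨∣p∣≡-p p
  ... | inj₁ e = subst (ℚ._≤ _) (sym e) h₁
  ... | inj₂ e = subst (ℚ._≤ _) (sym e) h₂

  abs-sub-≤ : ∀ a b → ℚ.∣ a ∣ ℚ.- ℚ.∣ b ∣ ℚ.≤ ℚ.∣ a ℚ.- b ∣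
  abs-sub-≤ a b = ≤-add⇒sub-≤ ℚ.∣ a ∣ ℚ.∣ b ∣ ℚ.∣ a ℚ.- b ∣
    (subst (λ z → ℚ.∣ z ∣ ℚ.≤ ℚ.∣ a ℚ.- b ∣ ℚ.+ ℚ.∣ b ∣)
    (sub-add a b) (ℚ.∣p+q∣≤∣p∣+∣q∣ (a ℚ.- b) b))

  abs-abs-sub-≤ : ∀ a b → ℚ.∣ ℚ.∣ a ∣ ℚ.- ℚ.∣ b ∣ ∣ ℚ.≤ ℚ.∣ a ℚ.- b ∣
  abs-abs-sub-≤ a b = abs-≤ (abs-sub-≤ a b)
    (subst₂ ℚ._≤_ (sym (neg-sub ℚ.∣ a ∣ ℚ.∣ b ∣)) (abs-sub-comm b a) (abs-sub-≤ b a))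

infixl 6 _-_
infix  4 _<_ _⟶_

fromℚ : ℚ → ℝ
fromℚ q = mkℝ (λ _ → q) λ ε 0<ε →
  0 , λ _ _ _ _ → subst (λ z → ℚ.∣ z ∣ ℚ.< ε) (sym (ℚ.+-inverseʳ q)) 0<ε

_-_ : ℝ → ℝ → ℝ
x - y = mkℝ (λ n → seq x n ℚ.- seq y n) λ ε 0<ε →
  let (M , hx) = cauchy x (½ ℚ.* ε) (half-pos 0<ε)
      (N , hy) = cauchy y (½ ℚ.* ε) (half-pos 0<ε)
  in M ℕ.⊔ N , λ m n m≥ n≥ → subst₂ ℚ._<_
       (cong ℚ.∣_∣ (sym (sub-interchange (seq x m) (seq y m) (seq x n) (seq y n))))
       (halve ε)
       (ℚ.≤-<-trans
         (ℚ.∣p-q∣≤∣p∣+∣q∣ (seq x m ℚ.- seq x n) (seq y m ℚ.- seq y n))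
         (ℚ.+-mono-<
           (hx m n (ℕ.m⊔n≤o⇒m≤o M N m≥) (ℕ.m⊔n≤o⇒m≤o M N n≥))
           (hy m n (ℕ.m⊔n≤o⇒n≤o M N m≥) (ℕ.m⊔n≤o⇒n≤o M N n≥))))

∣_∣ : ℝ → ℝ
∣ x ∣ = mkℝ (λ n → ℚ.∣ seq x n ∣) λ ε 0<ε →
  let (N , h) = cauchy x ε 0<ε
  in N , λ m n m≥ n≥ →
       ℚ.≤-<-trans (abs-abs-sub-≤ (seq x m) (seq x n)) (h m n m≥ n≥)

-- The gap δ is what makes this the strict order on the represented reals.
_<_ : ℝ → ℝ → Set
x < y = Σ[ δ ∈ ℚ ] 0ℚ ℚ.< δ ×
  (∃[ N ] ((n : ℕ) → N ℕ.≤ n → seq x n ℚ.+ δ ℚ.< seq y n))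

0ℝ 1ℝ : ℝ
0ℝ = fromℚ 0ℚ
1ℝ = fromℚ 1ℚ

_⟶_ : (ℕ → ℝ) → ℝ → Set
a ⟶ L = (ε : ℝ) → 0ℝ < ε → ∃[ N ] ((m : ℕ) → N ℕ.≤ m → ∣ a m - L ∣ < ε)

seq-⟶ : (x : ℝ) → (fromℚ ∘ seq x) ⟶ x
seq-⟶ x ε (δ , 0<δ , K , hε) =
  let (N , h) = cauchy x (½ ℚ.* δ) (half-pos 0<δ)
  in N , λ m m≥ → ½ ℚ.* δ , half-pos 0<δ , N ℕ.⊔ K , λ n n≥ →
       ℚ.<-trans
         (subst (ℚ.∣ seq x m ℚ.- seq x n ∣ ℚ.+ ½ ℚ.* δ ℚ.<_)
           (trans (halve δ) (sym (ℚ.+-identityˡ δ)))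
           (ℚ.+-monoˡ-< (½ ℚ.* δ) (h m n m≥ (ℕ.m⊔n≤o⇒m≤o N K n≥))))
         (hε n (ℕ.m⊔n≤o⇒n≤o N K n≥))

------------------------------------------------------------------------
-- The Riemann zeta function at integers s ≥ 2 (NonTrivial s).

-- zetaTerm s k = 1 / (k+1)^s
zetaTerm : ℕ → ℕ → ℚ
zetaTerm s k = _/_ (+ 1) (suc k ℕ.^ s) {{ℕ.m^n≢0 (suc k) s}}

-- zetaSum s N = Σ_{n=1}^{N} 1 / n^s
zetaSum : ℕ → ℕ → ℚ
zetaSum s zero    = 0ℚ
zetaSum s (suc N) = zetaSum s N ℚ.+ zetaTerm s N

private
  toℚᵘ-/ : ∀ i b .{{_ : ℕ.NonZero b}} → toℚᵘ (i / b) ℚᵘ.≃ (i ℚᵘ./ b)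
  toℚᵘ-/ i (suc b) = ℚ.toℚᵘ-fromℚᵘ (ℚᵘ.mkℚᵘ i b)

  0≤1/ : ∀ b .{{_ : ℕ.NonZero b}} → 0ℚ ℚ.≤ + 1 / b
  0≤1/ b@(suc _) = ℚ.toℚᵘ-cancel-≤ (ℚᵘ.≤-respʳ-≃ (ℚᵘ.≃-sym (toℚᵘ-/ (+ 1) b))
    (ℚᵘ.*≤* (ℤ.+≤+ z≤n)))

  1/-anti-≤ : ∀ a b .{{_ : ℕ.NonZero a}} .{{_ : ℕ.NonZero b}} → a ℕ.≤ b →
    + 1 / b ℚ.≤ + 1 / a
  1/-anti-≤ a@(suc _) b@(suc _) a≤b = ℚ.toℚᵘ-cancel-≤
    (ℚᵘ.≤-respʳ-≃ (ℚᵘ.≃-sym (toℚᵘ-/ (+ 1) a))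
    (ℚᵘ.≤-respˡ-≃ (ℚᵘ.≃-sym (toℚᵘ-/ (+ 1) b))
    (ℚᵘ.*≤* (ℤ.*-monoˡ-≤-nonNeg (+ 1) (ℤ.+≤+ a≤b)))))

  step-≤ : ∀ c b .{{_ : ℕ.NonZero c}} .{{_ : ℕ.NonZero b}} →
    c ℕ.* suc c ℕ.≤ b → + 1 / b ℚ.+ + 1 / suc c ℚ.≤ + 1 / c
  step-≤ c@(suc _) b@(suc _) h = ℚ.toℚᵘ-cancel-≤
    (ℚᵘ.≤-respʳ-≃ (ℚᵘ.≃-sym (toℚᵘ-/ (+ 1) c))
    (ℚᵘ.≤-respˡ-≃ (ℚᵘ.≃-sym (ℚᵘ.≃-trans (ℚ.toℚᵘ-homo-+ (+ 1 / b) (+ 1 / suc c))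
        (ℚᵘ.+-cong (toℚᵘ-/ (+ 1) b) (toℚᵘ-/ (+ 1) (suc c)))))
    (ℚᵘ.*≤* (ℤ.+≤+ (key c b h)))))
    where
    key : ∀ c b → c ℕ.* suc c ℕ.≤ b →
      (1 ℕ.* suc c ℕ.+ 1 ℕ.* b) ℕ.* c ℕ.≤ 1 ℕ.* (b ℕ.* suc c)
    key c b h = subst₂ ℕ._≤_ (e₁ c b) (e₂ c b) (ℕ.+-monoˡ-≤ (b ℕ.* c) h)
      where
      e₁ : ∀ c b → c ℕ.* suc c ℕ.+ b ℕ.* c ≡ (1 ℕ.* suc c ℕ.+ 1 ℕ.* b) ℕ.* c
      e₁ = ℕ-Solver.solve-∀
      e₂ : ∀ c b → b ℕ.+ b ℕ.* c ≡ 1 ℕ.* (b ℕ.* suc c)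
      e₂ = ℕ-Solver.solve-∀

  sq≤pow : ∀ c s .{{_ : ℕ.NonTrivial s}} → c ℕ.* suc c ℕ.≤ suc c ℕ.^ s
  sq≤pow c s = ℕ.≤-trans
    (ℕ.≤-trans (ℕ.*-monoˡ-≤ (suc c) (ℕ.n≤1+n c))
      (ℕ.≤-reflexive (cong (suc c ℕ.*_) (sym (ℕ.*-identityʳ (suc c))))))
    (ℕ.^-monoʳ-≤ (suc c) (ℕ.nonTrivial⇒n>1 s))

  module _ (s : ℕ) .{{_ : ℕ.NonTrivial s}} where

    zetaSum-mono : ∀ {m n} → m ℕ.≤′ n → zetaSum s m ℚ.≤ zetaSum s n
    zetaSum-mono ℕ.≤′-refl = ℚ.≤-refl
    zetaSum-mono {n = suc n} (ℕ.≤′-step h) = ℚ.≤-trans (zetaSum-mono h)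
      (subst (ℚ._≤ zetaSum s (suc n)) (ℚ.+-identityʳ (zetaSum s n))
        (ℚ.+-monoʳ-≤ (zetaSum s n) (0≤1/ (suc n ℕ.^ s) {{ℕ.m^n≢0 (suc n) s}})))

    upper : ℕ → ℚ
    upper k = zetaSum s (suc k) ℚ.+ + 1 / suc k

    upper-anti : ∀ {m n} → m ℕ.≤′ n → upper n ℚ.≤ upper m
    upper-anti ℕ.≤′-refl = ℚ.≤-refl
    upper-anti {n = suc n} (ℕ.≤′-step h) = ℚ.≤-trans
      (ℚ.≤-trans
        (ℚ.≤-reflexive (ℚ.+-assoc (zetaSum s (suc n)) (zetaTerm s (suc n)) (+ 1 / suc (suc n))))
        (ℚ.+-monoʳ-≤ (zetaSum s (suc n))
          (step-≤ (suc n) (suc (suc n) ℕ.^ s) {{_}} {{ℕ.m^n≢0 (suc (suc n)) s}}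
            (sq≤pow (suc n) s))))
      (upper-anti h)

    diff≤ : ∀ {K m n} → K ℕ.≤ m → m ℕ.≤ n →
      zetaSum s (suc n) ℚ.- zetaSum s (suc m) ℚ.≤ + 1 / suc K
    diff≤ {K} {m} {n} K≤m m≤n = ≤-add⇒sub-≤
      (zetaSum s (suc n)) (zetaSum s (suc m)) (+ 1 / suc K) (ℚ.≤-trans
      (subst (ℚ._≤ upper n) (ℚ.+-identityʳ (zetaSum s (suc n)))
        (ℚ.+-monoʳ-≤ (zetaSum s (suc n)) (0≤1/ (suc n))))
      (ℚ.≤-trans (upper-anti (ℕ.≤⇒≤′ m≤n))
      (ℚ.≤-trans (ℚ.+-monoʳ-≤ (zetaSum s (suc m)) (1/-anti-≤ (suc K) (suc m) (s≤s K≤m)))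
        (ℚ.≤-reflexive (ℚ.+-comm (zetaSum s (suc m)) (+ 1 / suc K))))))

    diff≤′ : ∀ {K m n} → K ℕ.≤ m → K ℕ.≤ n →
      zetaSum s (suc n) ℚ.- zetaSum s (suc m) ℚ.≤ + 1 / suc K
    diff≤′ {K} {m} {n} K≤m K≤n with ℕ.≤-total m n
    ... | inj₁ m≤n = diff≤ K≤m m≤n
    ... | inj₂ n≤m = ≤-add⇒sub-≤
      (zetaSum s (suc n)) (zetaSum s (suc m)) (+ 1 / suc K) (ℚ.≤-trans (zetaSum-mono (ℕ.≤⇒≤′ (s≤s n≤m)))
      (subst (ℚ._≤ + 1 / suc K ℚ.+ zetaSum s (suc m)) (ℚ.+-identityˡ (zetaSum s (suc m)))
        (ℚ.+-monoˡ-≤ (zetaSum s (suc m)) (0≤1/ (suc K)))))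

    absdiff≤ : ∀ K m n → suc K ℕ.≤ m → suc K ℕ.≤ n →
      ℚ.∣ zetaSum s m ℚ.- zetaSum s n ∣ ℚ.≤ + 1 / suc K
    absdiff≤ K (suc m) (suc n) (s≤s m≥) (s≤s n≥) = abs-≤ (diff≤′ n≥ m≥)
      (subst (ℚ._≤ _) (sym (neg-sub (zetaSum s (suc m)) (zetaSum s (suc n))))
        (diff≤′ m≥ n≥))

  archimedean : ∀ ε → 0ℚ ℚ.< ε → ∃[ K ] + 1 / suc K ℚ.< ε
  archimedean (mkℚ +[1+ p ] d _) _ = suc d , ℚ.toℚᵘ-cancel-<
    (ℚᵘ.<-respˡ-≃ (ℚᵘ.≃-sym (toℚᵘ-/ (+ 1) (suc (suc d))))
    (ℚᵘ.*<* (ℤ.+<+ (ℕ.<-≤-trans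
      (subst (ℕ._< suc (suc d)) (sym (ℕ.*-identityˡ (suc d))) (ℕ.n<1+n (suc d)))
      (ℕ.m≤m+n (suc (suc d)) (p ℕ.* suc (suc d)))))))
  archimedean (mkℚ +0 _ _)       (ℚ.*<* (ℤ.+<+ ()))
  archimedean (mkℚ -[1+ _ ] _ _) (ℚ.*<* ())

ζ : (s : ℕ) .{{_ : ℕ.NonTrivial s}} → ℝ
ζ s = mkℝ (zetaSum s) λ ε 0<ε →
  let (K , 1/K<ε) = archimedean ε 0<ε
  in suc K , λ m n m≥ n≥ → ℚ.≤-<-trans (absdiff≤ s K m n m≥ n≥) 1/K<ε

zetaSum-⟶-ζ : (s : ℕ) .{{_ : ℕ.NonTrivial s}} → (fromℚ ∘ zetaSum s) ⟶ ζ s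
zetaSum-⟶-ζ s = seq-⟶ (ζ s)

------------------------------------------------------------------------
-- Matrices and infinite products

Matrix : Set → ℕ → ℕ → Set
Matrix A m n = Vector (Vector A n) m

infixl 7 _⊗_

_⊗_ : ∀ {l m n} → Matrix ℚ l m → Matrix ℚ m n → Matrix ℚ l n
(A ⊗ B) i j = sum (λ k → A i k ℚ.* B k j)

identity : ∀ {d} → Matrix ℚ d d
identity i j = if does (i Fin.≟ j) then 1ℚ else 0ℚ

-- partialProduct M m = M 1 ⊗ M 2 ⊗ ⋯ ⊗ M m
partialProduct : ∀ {d} → ((n : ℕ) .{{_ : ℕ.NonZero n}} → Matrix ℚ d d) →
  ℕ → Matrix ℚ d d
partialProduct M zero    = identity
partialProduct M (suc m) = partialProduct M m ⊗ M (suc m)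

-- The factors are rational, so the finite products are formed over ℚ and
-- their entries are embedded into ℝ; the limit is taken in ℝ.
InfiniteProduct : ∀ {d} → ((n : ℕ) .{{_ : ℕ.NonZero n}} → Matrix ℚ d d) →
  Matrix ℝ d d → Set
InfiniteProduct {d} M L =
  (i j : Fin d) → (λ m → fromℚ (partialProduct M m i j)) ⟶ L i j

factor : (n : ℕ) .{{_ : ℕ.NonZero n}} → Matrix ℚ 3 3
factor n =
  (a  ∷ b  ∷ (+ 3 / (2 ℕ.* n ℕ.^ 3)) ∷ []) ∷
  (0ℚ ∷ a  ∷ (+ 3 / (2 ℕ.* n))       ∷ []) ∷
  (0ℚ ∷ 0ℚ ∷ 1ℚ                      ∷ []) ∷ []
  where
  instance
    2n≢0 : ℕ.NonZero (2 ℕ.* n)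
    2n≢0 = ℕ.m*n≢0 2 n
    2n+1≢0 : ℕ.NonZero (2 ℕ.* n ℕ.+ 1)
    2n+1≢0 = subst ℕ.NonZero (ℕ.+-comm 1 (2 ℕ.* n)) _
    2[2n+1]≢0 : ℕ.NonZero (2 ℕ.* (2 ℕ.* n ℕ.+ 1))
    2[2n+1]≢0 = ℕ.m*n≢0 2 (2 ℕ.* n ℕ.+ 1)
    2n[2n+1]≢0 : ℕ.NonZero (2 ℕ.* n ℕ.* (2 ℕ.* n ℕ.+ 1))
    2n[2n+1]≢0 = ℕ.m*n≢0 (2 ℕ.* n) (2 ℕ.* n ℕ.+ 1)
    2n³≢0 : ℕ.NonZero (2 ℕ.* n ℕ.^ 3)
    2n³≢0 = ℕ.m*n≢0 2 (n ℕ.^ 3) {{_}} {{ℕ.m^n≢0 n 3}}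
  a b : ℚ
  a = + n / (2 ℕ.* (2 ℕ.* n ℕ.+ 1))
  b = ℤ.- + 3 / (2 ℕ.* n ℕ.* (2 ℕ.* n ℕ.+ 1))

limitMatrix : Matrix ℝ 3 3
limitMatrix =
  (0ℝ ∷ 0ℝ ∷ ζ 4 ∷ []) ∷
  (0ℝ ∷ 0ℝ ∷ ζ 2 ∷ []) ∷
  (0ℝ ∷ 0ℝ ∷ 1ℝ  ∷ []) ∷ []

{-# OPTIONS --safe #-}

-- Write K = k + 1 and, for n, k ≥ 0,
--
--   F(n,k;x) = n!² / (2n)! · ∏_{j=1}^{n} (j² - 4x²) / ∏_{j=0}^{n} ((K + j)² - x²).
--
-- With R(n,k) = (2K + 3n + 1) / (2 (2n + 1)) and G = R F one has the WZ equation
-- F(n,k) - F(n+1,k) = G(n,k) - G(n,k+1).  Summing it over a box gives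
-- Σ_k 1/(K² - x²) = Σ_n G(n,0;x) up to boundary terms.  The coefficients of x⁰ and
-- x² of G(n,0;x) are the summands that the matrix product accumulates in its last
-- column, while those of 1/(K² - x²) are 1/K² and 1/K⁴.  On the m × m box the
-- boundary terms are O(1/m), since F decays like 2⁻ⁿ/K² and R is at most 2K.

module Submission where

open import Defs hiding (_-_; ∣_∣; _<_)

open import Data.Fin.Patterns using (0F; 1F; 2F)
open import Data.Integer.Base as ℤ using (+_; -[1+_]; +[1+_]; +0)
import Data.Integer.Properties as ℤ
open import Data.Nat.Base as ℕ using (ℕ; zero; suc)
import Data.Nat.Properties as ℕ
open import Data.Product.Base using (∃-syntax; _,_)
open import Data.Rational.Base
import Data.Rational.Properties as ℚ
open import Algebra.Properties.CommutativeMonoid.Sum ℚ.+-0-commutativeMonoid using (sum-cong-≗)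
import Data.Rational.Unnormalised.Base as ℚᵘ
import Data.Rational.Unnormalised.Properties as ℚᵘ
open import Data.Vec.Functional using ([]; _∷_)
open import Function.Base using (_∘_)
open import Level using (0ℓ)
open import Relation.Binary.PropositionalEquality
open import Relation.Nullary.Decidable.Core using (dec⇒maybe)
open import Tactic.RingSolver using (solve-∀)
open import Tactic.RingSolver.Core.AlmostCommutativeRing using (AlmostCommutativeRing; fromCommutativeRing)

-- The commutative ring of rationals and its numerals

ℚ-ring : AlmostCommutativeRing 0ℓ 0ℓ
ℚ-ring = fromCommutativeRing ℚ.+-*-commutativeRing (λ x → dec⇒maybe (0ℚ ℚ.≟ x))

2ℚ 3ℚ 4ℚ 5ℚ 8ℚ 9ℚ : ℚ
2ℚ = + 2 / 1
3ℚ = + 3 / 1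
4ℚ = + 4 / 1
5ℚ = + 5 / 1
8ℚ = + 8 / 1
9ℚ = + 9 / 1

-- Fractions with natural denominators

fromℕ : ℕ → ℚ
fromℕ n = + n / 1

toℚᵘ-/ : ∀ i d .{{_ : ℕ.NonZero d}} → toℚᵘ (i / d) ℚᵘ.≃ (i ℚᵘ./ d)
toℚᵘ-/ i (suc d) = ℚ.toℚᵘ-fromℚᵘ (ℚᵘ.mkℚᵘ i d)

fromℕ-+ : ∀ m n → fromℕ (m ℕ.+ n) ≡ fromℕ m + fromℕ n
fromℕ-+ m n = ℚ.toℚᵘ-injective (ℚᵘ.≃-trans (toℚᵘ-/ (+ (m ℕ.+ n)) 1)
  (ℚᵘ.≃-sym (ℚᵘ.≃-trans (ℚ.toℚᵘ-homo-+ (fromℕ m) (fromℕ n))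
  (ℚᵘ.≃-trans (ℚᵘ.+-cong (toℚᵘ-/ (+ m) 1) (toℚᵘ-/ (+ n) 1))
  (ℚᵘ.*≡* (cong (ℤ._* + 1) (cong₂ ℤ._+_ (ℤ.*-identityʳ (+ m)) (ℤ.*-identityʳ (+ n)))))))))

fromℕ-* : ∀ m n → fromℕ (m ℕ.* n) ≡ fromℕ m * fromℕ n
fromℕ-* m n = ℚ.toℚᵘ-injective (ℚᵘ.≃-trans (toℚᵘ-/ (+ (m ℕ.* n)) 1)
  (ℚᵘ.≃-sym (ℚᵘ.≃-trans (ℚ.toℚᵘ-homo-* (fromℕ m) (fromℕ n))
  (ℚᵘ.≃-trans (ℚᵘ.*-cong (toℚᵘ-/ (+ m) 1) (toℚᵘ-/ (+ n) 1))
  (ℚᵘ.*≡* (cong (ℤ._* + 1) (sym (ℤ.pos-* m n))))))))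

/-as-* : ∀ i d .{{_ : ℕ.NonZero d}} → i / d ≡ (i / 1) * (+ 1 / d)
/-as-* i d@(suc d-1) = ℚ.toℚᵘ-injective (ℚᵘ.≃-trans (toℚᵘ-/ i d)
  (ℚᵘ.≃-sym (ℚᵘ.≃-trans (ℚ.toℚᵘ-homo-* (i / 1) (+ 1 / d))
  (ℚᵘ.≃-trans (ℚᵘ.*-cong (toℚᵘ-/ i 1) (toℚᵘ-/ (+ 1) d))
  (ℚᵘ.*≡* (cong₂ ℤ._*_ (ℤ.*-identityʳ i) (cong +[1+_] (sym (ℕ.+-identityʳ d-1)))))))))

fromℕ-inverse : ∀ d .{{_ : ℕ.NonZero d}} → fromℕ d * (+ 1 / d) ≡ 1ℚ
fromℕ-inverse d@(suc d-1) = trans (sym (/-as-* (+ d) d))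
  (ℚ.fromℚᵘ-cong {ℚᵘ.mkℚᵘ (+ d) d-1} {ℚᵘ.1ℚᵘ} (ℚᵘ.*≡* (ℤ.*-comm (+ d) (+ 1))))

-- Inverses in a commutative ring are unique. This trades a fraction with a compound denominator for
-- a product of known reciprocals.
/-unique : ∀ i d .{{_ : ℕ.NonZero d}} {u} → fromℕ d * u ≡ 1ℚ → i / d ≡ (i / 1) * u
/-unique i d {u} du≡1 = trans (/-as-* i d) (cong ((i / 1) *_) (begin
  + 1 / d                         ≡⟨ ℚ.*-identityʳ _ ⟨
  (+ 1 / d) * 1ℚ                  ≡⟨ cong ((+ 1 / d) *_) du≡1 ⟨
  (+ 1 / d) * (fromℕ d * u)       ≡⟨ swap (+ 1 / d) (fromℕ d) u ⟩
  (fromℕ d * (+ 1 / d)) * u       ≡⟨ cong (_* u) (fromℕ-inverse d) ⟩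
  1ℚ * u                          ≡⟨ ℚ.*-identityˡ u ⟩
  u                               ∎))
  where
  open ≡-Reasoning
  swap : ∀ a b c → a * (b * c) ≡ (b * a) * c
  swap = solve-∀ ℚ-ring

fromℕ-nonneg : ∀ n → 0ℚ ≤ fromℕ n
fromℕ-nonneg n = ℚ.toℚᵘ-cancel-≤ (ℚᵘ.≤-respʳ-≃ (ℚᵘ.≃-sym (toℚᵘ-/ (+ n) 1))
  (ℚᵘ.*≤* (subst (ℤ.0ℤ ℤ.≤_) (sym (ℤ.*-identityʳ (+ n))) (ℤ.+≤+ ℕ.z≤n))))

1/-nonneg : ∀ d .{{_ : ℕ.NonZero d}} → 0ℚ ≤ + 1 / d
1/-nonneg d@(suc _) = ℚ.toℚᵘ-cancel-≤ (ℚᵘ.≤-respʳ-≃ (ℚᵘ.≃-sym (toℚᵘ-/ (+ 1) d))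
  (ℚᵘ.*≤* (ℤ.+≤+ ℕ.z≤n)))

-- The letters in which the identities below become polynomial; relations such as `N n * r n ≡ 1ℚ`
-- are supplied as equations. `w n` is `1/(2(2n+1))`: when `n` grows by one, `n!²/(2n)!` gains the
-- factor `N n * w n`.
N r w : ℕ → ℚ
N n = fromℕ (suc n)
r n = + 1 / suc n
w n = + 1 / (2 ℕ.* suc (2 ℕ.* n))

N-suc : ∀ n → N (suc n) ≡ 1ℚ + N n
N-suc n = fromℕ-+ 1 (suc n)

N≡1+ : ∀ n → N n ≡ 1ℚ + fromℕ n
N≡1+ n = fromℕ-+ 1 n

N-nonneg : ∀ n → 0ℚ ≤ N n
N-nonneg n = fromℕ-nonneg (suc n)

r-nonneg : ∀ n → 0ℚ ≤ r n
r-nonneg n = 1/-nonneg (suc n)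

w-nonneg : ∀ n → 0ℚ ≤ w n
w-nonneg n = 1/-nonneg (2 ℕ.* suc (2 ℕ.* n))

N*r≡1 : ∀ n → N n * r n ≡ 1ℚ
N*r≡1 n = fromℕ-inverse (suc n)

-- With `K = k + 1`, `r (suc (n + k))` is `1/(K + n + 1)`, the reciprocal that enters both on
-- passing from `F(n,k)` to `F(n+1,k)` and on passing to `F(n,k+1)`.
[N+N]*r≡1 : ∀ n k → (N k + N n) * r (suc (n ℕ.+ k)) ≡ 1ℚ
[N+N]*r≡1 n k = trans (cong (_* r (suc (n ℕ.+ k))) (begin
  N k + N n                  ≡⟨ fromℕ-+ (suc k) (suc n) ⟨
  fromℕ (suc k ℕ.+ suc n)    ≡⟨ cong fromℕ (ℕ.+-comm (suc k) (suc n)) ⟩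
  fromℕ (suc n ℕ.+ suc k)    ≡⟨ cong N (ℕ.+-suc n k) ⟩
  N (suc (n ℕ.+ k))          ∎)) (N*r≡1 (suc (n ℕ.+ k)))
  where open ≡-Reasoning

fromℕ-w : ∀ n → fromℕ (2 ℕ.* suc (2 ℕ.* n)) ≡ 2ℚ * (2ℚ * fromℕ n + 1ℚ)
fromℕ-w n = trans (fromℕ-* 2 (suc (2 ℕ.* n))) (cong (2ℚ *_)
  (trans (fromℕ-+ 1 (2 ℕ.* n)) (trans (ℚ.+-comm 1ℚ (fromℕ (2 ℕ.* n))) (cong (_+ 1ℚ) (fromℕ-* 2 n)))))

[2n+1]*w≡1 : ∀ n → 2ℚ * (2ℚ * fromℕ n + 1ℚ) * w n ≡ 1ℚ
[2n+1]*w≡1 n = trans (cong (_* w n) (sym (fromℕ-w n)))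
  (fromℕ-inverse (2 ℕ.* suc (2 ℕ.* n)))

[2N-1]*w≡1 : ∀ n → 2ℚ * (2ℚ * N n - 1ℚ) * w n ≡ 1ℚ
[2N-1]*w≡1 n = trans (cong (λ x → 2ℚ * (2ℚ * x - 1ℚ) * w n) (N≡1+ n))
  (trans (shift (fromℕ n) (w n)) ([2n+1]*w≡1 n))
  where
  shift : ∀ x y → 2ℚ * (2ℚ * (1ℚ + x) - 1ℚ) * y ≡ 2ℚ * (2ℚ * x + 1ℚ) * y
  shift = solve-∀ ℚ-ring

[2N+1]*w≡1 : ∀ n → 2ℚ * (2ℚ * N n + 1ℚ) * w (suc n) ≡ 1ℚ
[2N+1]*w≡1 n = [2n+1]*w≡1 (suc n)

-- Partial fractions of `1/((n+1)(n+2))`. This drives the monotonicity of `r` and the comparisons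
-- with `geo` and with the sums of squares.
recip-step : ∀ n → r n ≡ r (suc n) + r n * r (suc n)
recip-step n = begin
  r n                                     ≡⟨ ℚ.*-identityʳ (r n) ⟨
  r n * 1ℚ                                ≡⟨ cong (r n *_) (N*r≡1 (suc n)) ⟨
  r n * (N (suc n) * r (suc n))           ≡⟨ cong (λ x → r n * (x * r (suc n))) (N-suc n) ⟩
  r n * ((1ℚ + N n) * r (suc n))          ≡⟨ expand (r n) (N n) (r (suc n)) ⟩
  (N n * r n) * r (suc n) + r n * r (suc n) ≡⟨ cong (λ x → x * r (suc n) + r n * r (suc n)) (N*r≡1 n) ⟩
  1ℚ * r (suc n) + r n * r (suc n)        ≡⟨ cong (_+ r n * r (suc n)) (ℚ.*-identityˡ (r (suc n))) ⟩
  r (suc n) + r n * r (suc n)             ∎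
  where
  open ≡-Reasoning
  expand : ∀ a b c → a * ((1ℚ + b) * c) ≡ (b * a) * c + a * c
  expand = solve-∀ ℚ-ring

-- The WZ pair

-- F(n,k;x) = f n k (1 + h n k x² + O(x⁴)), and R does not involve x.
f : ℕ → ℕ → ℚ
f zero    k = r k * r k
f (suc n) k = f n k * (N n * N n * N n * w n * (r (suc (n ℕ.+ k)) * r (suc (n ℕ.+ k))))

h : ℕ → ℕ → ℚ
h zero    k = r k * r k
h (suc n) k = h n k + (r (suc (n ℕ.+ k)) * r (suc (n ℕ.+ k)) - 4ℚ * (r n * r n))

fh : ℕ → ℕ → ℚ
fh n k = f n k * h n k

R : ℕ → ℕ → ℚ
R n k = (2ℚ * N k + 3ℚ * N n - 2ℚ) * w n

R-suc : ∀ n k → R n (suc k) ≡ (2ℚ * N k + 3ℚ * N n) * w n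
R-suc n k = trans (cong (λ x → (2ℚ * x + 3ℚ * N n - 2ℚ) * w n) (N-suc k))
  (shift (N k) (N n) (w n))
  where
  shift : ∀ x y z → (2ℚ * (1ℚ + x) + 3ℚ * y - 2ℚ) * z ≡ (2ℚ * x + 3ℚ * y) * z
  shift = solve-∀ ℚ-ring

-- Raising `k` moves the window `K, ..., K + n` of squared denominators by one: `K²` leaves and
-- `(K + n + 1)²` enters.
f-shift : ∀ n k → f n (suc k) ≡
  f n k * (N k * N k * (r (suc (n ℕ.+ k)) * r (suc (n ℕ.+ k))))
f-shift zero k = sym (trans (expand (N k) (r k) (r (suc k)))
  (trans (cong (λ x → x * x * (r (suc k) * r (suc k))) (N*r≡1 k)) (ℚ.*-identityˡ _)))
  where
  expand : ∀ a b c → b * b * (a * a * (c * c)) ≡ (a * b) * (a * b) * (c * c)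
  expand = solve-∀ ℚ-ring
f-shift (suc n) k rewrite ℕ.+-suc n k = trans
  (cong (_* (N n * N n * N n * w n * (r (suc (suc (n ℕ.+ k))) * r (suc (suc (n ℕ.+ k))))))
    (f-shift n k))
  (swap (f n k) (N k * N k) (r (suc (n ℕ.+ k)) * r (suc (n ℕ.+ k))) (N n * N n * N n * w n)
    (r (suc (suc (n ℕ.+ k))) * r (suc (suc (n ℕ.+ k)))))
  where
  swap : ∀ a b c d e → a * (b * c) * (d * e) ≡ a * (d * c) * (b * e)
  swap = solve-∀ ℚ-ring

-- The same exchange seen in the x² coefficient: a factor `1/(j² - x²)` contributes `1/j²` to `h`.
h-shift : ∀ n k → h n (suc k) ≡
  h n k + (r (suc (n ℕ.+ k)) * r (suc (n ℕ.+ k)) - r k * r k)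
h-shift zero k = expand (r k * r k) (r (suc k) * r (suc k))
  where
  expand : ∀ a b → b ≡ a + (b - a)
  expand = solve-∀ ℚ-ring
h-shift (suc n) k rewrite ℕ.+-suc n k = trans
  (cong (_+ (r (suc (suc (n ℕ.+ k))) * r (suc (suc (n ℕ.+ k))) - 4ℚ * (r n * r n)))
    (h-shift n k))
  (swap (h n k) (r (suc (n ℕ.+ k)) * r (suc (n ℕ.+ k))) (r k * r k)
    (r (suc (suc (n ℕ.+ k))) * r (suc (suc (n ℕ.+ k)))) (4ℚ * (r n * r n)))
  where
  swap : ∀ a b c d e → a + (b - c) + (d - e) ≡ a + (b - e) + (d - c)
  swap = solve-∀ ℚ-ring

-- Multiplying the constant terms by p = 2 (2 N - 1) w = 1 and q = (K + N) v = 1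
-- makes both sides homogeneous, so that they agree as polynomials.
f-certificate : ∀ x K N w v → 2ℚ * (2ℚ * N - 1ℚ) * w ≡ 1ℚ → (K + N) * v ≡ 1ℚ →
  x - x * (N * N * N * w * (v * v)) ≡
  (2ℚ * K + 3ℚ * N - 2ℚ) * w * x - (2ℚ * K + 3ℚ * N) * w * (x * (K * K * (v * v)))
f-certificate x K N w v p≡1 q≡1 = begin
  x - x * (N * N * N * w * (v * v))
    ≡⟨ cong (_- x * (N * N * N * w * (v * v))) (ones x) ⟩
  x * (1ℚ * (1ℚ * 1ℚ)) - x * (N * N * N * w * (v * v))
    ≡⟨ cong₂ (λ p q → x * (p * (q * q)) - x * (N * N * N * w * (v * v))) p≡1 q≡1 ⟨
  x * (2ℚ * (2ℚ * N - 1ℚ) * w * ((K + N) * v * ((K + N) * v))) - x * (N * N * N * w * (v * v))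
    ≡⟨ poly x K N w v ⟩
  (2ℚ * K + 3ℚ * N - 2ℚ) * w * (x * ((K + N) * v * ((K + N) * v))) -
    (2ℚ * K + 3ℚ * N) * w * (x * (K * K * (v * v)))
    ≡⟨ cong (λ q → (2ℚ * K + 3ℚ * N - 2ℚ) * w * (x * (q * q)) -
         (2ℚ * K + 3ℚ * N) * w * (x * (K * K * (v * v)))) q≡1 ⟩
  (2ℚ * K + 3ℚ * N - 2ℚ) * w * (x * (1ℚ * 1ℚ)) -
    (2ℚ * K + 3ℚ * N) * w * (x * (K * K * (v * v)))
    ≡⟨ cong (λ y → (2ℚ * K + 3ℚ * N - 2ℚ) * w * y -
         (2ℚ * K + 3ℚ * N) * w * (x * (K * K * (v * v)))) (ℚ.*-identityʳ x) ⟩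
  (2ℚ * K + 3ℚ * N - 2ℚ) * w * x - (2ℚ * K + 3ℚ * N) * w * (x * (K * K * (v * v))) ∎
  where
  open ≡-Reasoning
  ones : ∀ x → x ≡ x * (1ℚ * (1ℚ * 1ℚ))
  ones = solve-∀ ℚ-ring
  poly : ∀ x K N w v →
    x * (2ℚ * (2ℚ * N - 1ℚ) * w * ((K + N) * v * ((K + N) * v))) - x * (N * N * N * w * (v * v)) ≡
    (2ℚ * K + 3ℚ * N - 2ℚ) * w * (x * ((K + N) * v * ((K + N) * v))) -
      (2ℚ * K + 3ℚ * N) * w * (x * (K * K * (v * v)))
  poly = solve-∀ ℚ-ring

-- What the WZ equation demands at order x² beyond the equation for `f`. Since `N * r` and `K * ρ`
-- both equal `(K + N) * v`, each side becomes `w v⁴` times a polynomial, and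
-- `N³ - 4N(K+N)² = (2K+3N)(K² - (K+N)²)`.
h-certificate : ∀ K N w v r ρ → N * r ≡ 1ℚ → K * ρ ≡ 1ℚ → (K + N) * v ≡ 1ℚ →
  N * N * N * w * (v * v) * (v * v - 4ℚ * (r * r)) ≡
  (2ℚ * K + 3ℚ * N) * w * (K * K * (v * v)) * (v * v - ρ * ρ)
h-certificate K N w v r ρ Nr≡1 Kρ≡1 q≡1 = begin
  N * N * N * w * (v * v) * (v * v - 4ℚ * (r * r))
    ≡⟨ expandˡ N w v r ⟩
  w * (v * v) * (N * N * N * (v * v) - 4ℚ * (N * (N * r * (N * r))))
    ≡⟨ cong (λ y → w * (v * v) * (N * N * N * (v * v) - 4ℚ * (N * (y * y)))) (trans Nr≡1 (sym q≡1)) ⟩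
  w * (v * v) * (N * N * N * (v * v) - 4ℚ * (N * ((K + N) * v * ((K + N) * v))))
    ≡⟨ poly K N w v ⟩
  (2ℚ * K + 3ℚ * N) * w * (v * v) * (K * K * (v * v) - (K + N) * v * ((K + N) * v))
    ≡⟨ cong (λ y → (2ℚ * K + 3ℚ * N) * w * (v * v) * (K * K * (v * v) - y * y)) (trans q≡1 (sym Kρ≡1)) ⟩
  (2ℚ * K + 3ℚ * N) * w * (v * v) * (K * K * (v * v) - K * ρ * (K * ρ))
    ≡⟨ expandʳ K ((2ℚ * K + 3ℚ * N) * w) v ρ ⟩
  (2ℚ * K + 3ℚ * N) * w * (K * K * (v * v)) * (v * v - ρ * ρ) ∎
  where
  open ≡-Reasoning
  expandˡ : ∀ N w v r → N * N * N * w * (v * v) * (v * v - 4ℚ * (r * r)) ≡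
    w * (v * v) * (N * N * N * (v * v) - 4ℚ * (N * (N * r * (N * r))))
  expandˡ = solve-∀ ℚ-ring
  expandʳ : ∀ K y v ρ → y * (v * v) * (K * K * (v * v) - K * ρ * (K * ρ)) ≡
    y * (K * K * (v * v)) * (v * v - ρ * ρ)
  expandʳ = solve-∀ ℚ-ring
  poly : ∀ K N w v →
    w * (v * v) * (N * N * N * (v * v) - 4ℚ * (N * ((K + N) * v * ((K + N) * v)))) ≡
    (2ℚ * K + 3ℚ * N) * w * (v * v) * (K * K * (v * v) - (K + N) * v * ((K + N) * v))
  poly = solve-∀ ℚ-ring

f-telescopes : ∀ n k → f n k - f (suc n) k ≡ R n k * f n k - R n (suc k) * f n (suc k)
f-telescopes n k = trans
  (f-certificate (f n k) (N k) (N n) (w n) (r (suc (n ℕ.+ k))) ([2N-1]*w≡1 n) ([N+N]*r≡1 n k))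
  (cong₂ (λ a b → R n k * f n k - a * b) (sym (R-suc n k)) (sym (f-shift n k)))

-- A product rule: with `c`, `c′` the ratios of `f` and `d`, `d′` the increments of `h`, the
-- difference is the equation for `f` times `h n k`, minus `f n k` times the equation of
-- `h-certificate`.
fh-telescopes : ∀ n k → fh n k - fh (suc n) k ≡ R n k * fh n k - R n (suc k) * fh n (suc k)
fh-telescopes n k = begin
  x * y - x * c * (y + d)
    ≡⟨ split x y c d ⟩
  (x - x * c) * y - x * (c * d)
    ≡⟨ cong₂ (λ s t → s * y - x * t)
         (f-certificate x (N k) (N n) (w n) v ([2N-1]*w≡1 n) ([N+N]*r≡1 n k))
         (h-certificate (N k) (N n) (w n) v (r n) (r k) (N*r≡1 n) (N*r≡1 k) ([N+N]*r≡1 n k)) ⟩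
  (R n k * x - R′ * (x * c′)) * y - x * (R′ * c′ * d′)
    ≡⟨ merge x y (R n k) R′ c′ d′ ⟩
  R n k * (x * y) - R′ * (x * c′ * (y + d′))
    ≡⟨ cong₂ (λ s t → R n k * (x * y) - s * t) (sym (R-suc n k))
         (sym (cong₂ _*_ (f-shift n k) (h-shift n k))) ⟩
  R n k * (x * y) - R n (suc k) * fh n (suc k) ∎
  where
  open ≡-Reasoning
  x = f n k
  y = h n k
  v = r (suc (n ℕ.+ k))
  c = N n * N n * N n * w n * (v * v)
  d = v * v - 4ℚ * (r n * r n)
  R′ = (2ℚ * N k + 3ℚ * N n) * w n
  c′ = N k * N k * (v * v)
  d′ = v * v - r k * r k
  split : ∀ x y c d → x * y - x * c * (y + d) ≡ (x - x * c) * y - x * (c * d)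
  split = solve-∀ ℚ-ring
  merge : ∀ x y R R′ c d → (R * x - R′ * (x * c)) * y - x * (R′ * c * d) ≡
    R * (x * y) - R′ * (x * c * (y + d))
  merge = solve-∀ ℚ-ring

-- Finite sums and summation of a WZ pair over a box

∑ : ℕ → (ℕ → ℚ) → ℚ
∑ zero    u = 0ℚ
∑ (suc n) u = ∑ n u + u n

∑-cong : ∀ {u v : ℕ → ℚ} → (∀ i → u i ≡ v i) → ∀ n → ∑ n u ≡ ∑ n v
∑-cong u≗v zero    = refl
∑-cong u≗v (suc n) = cong₂ _+_ (∑-cong u≗v n) (u≗v n)

-- A discrete Green's theorem on the `m` by `K` box: the two sides through the origin balance the
-- two far sides. Each step of the induction adds one row, which telescopes in `k`.
telescope : ∀ (F G : ℕ → ℕ → ℚ) →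
  (∀ n k → F n k - F (suc n) k ≡ G n k - G n (suc k)) →
  ∀ m K → ∑ K (F 0) - ∑ m (λ n → G n 0) ≡ ∑ K (F m) - ∑ m (λ n → G n K)
telescope F G FG zero    K = refl
telescope F G FG (suc m) K = begin
  ∑ K (F 0) - (∑ m (λ n → G n 0) + G m 0)
    ≡⟨ regroup₁ (∑ K (F 0)) (∑ m (λ n → G n 0)) (G m 0) ⟩
  (∑ K (F 0) - ∑ m (λ n → G n 0)) - G m 0
    ≡⟨ cong (_- G m 0) (telescope F G FG m K) ⟩
  (∑ K (F m) - ∑ m (λ n → G n K)) - G m 0
    ≡⟨ regroup₂ (∑ K (F m)) (∑ K (F (suc m))) (∑ m (λ n → G n K)) (G m 0) ⟩
  (∑ K (F m) - ∑ K (F (suc m))) + (∑ K (F (suc m)) - ∑ m (λ n → G n K) - G m 0)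
    ≡⟨ cong (_+ (∑ K (F (suc m)) - ∑ m (λ n → G n K) - G m 0)) (row K) ⟩
  (G m 0 - G m K) + (∑ K (F (suc m)) - ∑ m (λ n → G n K) - G m 0)
    ≡⟨ regroup₃ (G m 0) (G m K) (∑ K (F (suc m))) (∑ m (λ n → G n K)) ⟩
  ∑ K (F (suc m)) - (∑ m (λ n → G n K) + G m K) ∎
  where
  open ≡-Reasoning
  regroup₁ : ∀ a b c → a - (b + c) ≡ (a - b) - c
  regroup₁ = solve-∀ ℚ-ring
  regroup₂ : ∀ a b c d → (a - c) - d ≡ (a - b) + (b - c - d)
  regroup₂ = solve-∀ ℚ-ring
  regroup₃ : ∀ a b c d → (a - b) + (c - d - a) ≡ c - (d + b)
  regroup₃ = solve-∀ ℚ-ring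
  regroup₄ : ∀ a b c d → (a + b) - (c + d) ≡ (a - c) + (b - d)
  regroup₄ = solve-∀ ℚ-ring
  regroup₅ : ∀ a b c → (a - b) + (b - c) ≡ a - c
  regroup₅ = solve-∀ ℚ-ring
  row : ∀ K → ∑ K (F m) - ∑ K (F (suc m)) ≡ G m 0 - G m K
  row zero    = sym (ℚ.+-inverseʳ (G m 0))
  row (suc K) = trans (regroup₄ (∑ K (F m)) (F m K) (∑ K (F (suc m))) (F (suc m) K))
    (trans (cong₂ _+_ (row K) (FG m K)) (regroup₅ (G m 0) (G m K) (G m (suc K))))

-- Partial sums of ζ(2) and ζ(4)

zetaSum≡∑ : ∀ s n → zetaSum s n ≡ ∑ n (zetaTerm s)
zetaSum≡∑ s zero    = refl
zetaSum≡∑ s (suc n) = cong (_+ zetaTerm s n) (zetaSum≡∑ s n)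

inverse-pow : ∀ {a b} k s → fromℕ k * a ≡ 1ℚ → fromℕ (k ℕ.^ s) * b ≡ 1ℚ →
  fromℕ (k ℕ.^ suc s) * (a * b) ≡ 1ℚ
inverse-pow {a} {b} k s ka≡1 kb≡1 = trans (cong (_* (a * b)) (fromℕ-* k (k ℕ.^ s)))
  (trans (swap (fromℕ k) (fromℕ (k ℕ.^ s)) a b) (cong₂ _*_ ka≡1 kb≡1))
  where
  swap : ∀ a b c d → a * b * (c * d) ≡ (a * c) * (b * d)
  swap = solve-∀ ℚ-ring

inverse-^2 : ∀ k → fromℕ (suc k ℕ.^ 2) * (r k * r k) ≡ 1ℚ
inverse-^2 k = inverse-pow (suc k) 1 (N*r≡1 k)
  (trans (cong (λ n → fromℕ n * r k) (ℕ.*-identityʳ (suc k))) (N*r≡1 k))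

zetaTerm-2 : ∀ k → zetaTerm 2 k ≡ r k * r k
zetaTerm-2 k = trans (/-unique (+ 1) (suc k ℕ.^ 2) (inverse-^2 k)) (ℚ.*-identityˡ (r k * r k))

zetaTerm-4 : ∀ k → zetaTerm 4 k ≡ r k * r k * (r k * r k)
zetaTerm-4 k = trans
  (/-unique (+ 1) (suc k ℕ.^ 4) (inverse-pow (suc k) 3 (N*r≡1 k) (inverse-pow (suc k) 2 (N*r≡1 k) (inverse-^2 k))))
  (trans (ℚ.*-identityˡ (r k * (r k * (r k * r k)))) (assoc (r k)))
  where
  assoc : ∀ a → a * (a * (a * a)) ≡ a * a * (a * a)
  assoc = solve-∀ ℚ-ring

zetaSum-2 : ∀ m → zetaSum 2 m ≡ ∑ m (f 0)
zetaSum-2 m = trans (zetaSum≡∑ 2 m) (∑-cong zetaTerm-2 m)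

-- The x² coefficient of `1/(K² - x²)` is `1/K⁴`, and `fh 0` unfolds to it.
zetaSum-4 : ∀ m → zetaSum 4 m ≡ ∑ m (fh 0)
zetaSum-4 m = trans (zetaSum≡∑ 4 m) (∑-cong zetaTerm-4 m)

-- The partial products in closed form

-- `A m` is `m!²/(2m+1)!`, the product of the diagonal entries, expressed through `f m 0` so that it
-- can be compared with the summands of `S₂` and `S₄`. `Z m` is the partial sum of ζ(2); `S₂` and
-- `S₄` sum the x⁰ and x² coefficients of `G(n,0;x)`.
A Z S₂ S₄ : ℕ → ℚ
A m  = f m 0 * (2ℚ * (N m * N m) * w m)
Z m  = ∑ m (f 0)
S₂ m = ∑ m (λ n → R n 0 * f n 0)
S₄ m = ∑ m (λ n → R n 0 * fh n 0)

closedForm : ℕ → Matrix ℚ 3 3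
closedForm m =
  (A m ∷ - (3ℚ * (A m * Z m)) ∷ S₄ m ∷ []) ∷
  (0ℚ  ∷ A m                  ∷ S₂ m ∷ []) ∷
  (0ℚ  ∷ 0ℚ                   ∷ 1ℚ   ∷ []) ∷ []

A-suc : ∀ m → A (suc m) ≡ A m * (N m * w (suc m))
A-suc m = trans
  (cong (λ x → f (suc m) 0 * (2ℚ * (x * x) * w (suc m))) (N-suc m))
  (trans (gather (f m 0) (N m) (w m) (r (suc (m ℕ.+ 0))) (w (suc m)))
  (trans (cong (λ q → f m 0 * (2ℚ * (N m * N m) * w m) * (N m * w (suc m)) * (q * q))
           ([N+N]*r≡1 m 0))
    (ℚ.*-identityʳ (A m * (N m * w (suc m))))))
  where
  gather : ∀ x N w v w′ →
    x * (N * N * N * w * (v * v)) * (2ℚ * ((1ℚ + N) * (1ℚ + N)) * w′) ≡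
    x * (2ℚ * (N * N) * w) * (N * w′) * ((1ℚ + N) * v * ((1ℚ + N) * v))
  gather = solve-∀ ℚ-ring

-- At `K = 1` the denominators contribute `1/j²` for `j ≤ m + 1` and the factors `j² - 4x²`
-- contribute `-4/j²` for `1 ≤ j ≤ m`. The common range leaves `-3` times the partial sum of ζ(2),
-- which is how `Z` enters the upper right entries.
h-0 : ∀ m → h m 0 ≡ r m * r m - 3ℚ * Z m
h-0 zero    = refl
h-0 (suc m) rewrite ℕ.+-identityʳ m = trans
  (cong (_+ (r (suc m) * r (suc m) - 4ℚ * (r m * r m))) (h-0 m))
  (regroup (r m * r m) (Z m) (r (suc m) * r (suc m)))
  where
  regroup : ∀ a z b → a - 3ℚ * z + (b - 4ℚ * a) ≡ b - 3ℚ * (z + a)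
  regroup = solve-∀ ℚ-ring

-- At `K = 1` the numerator of `R` collapses to `3 * N m`. The right side is what multiplication by
-- the next factor adds to the middle entry of the last column.
R*f-0 : ∀ m → R m 0 * f m 0 ≡ A m * (3ℚ * (½ * r m))
R*f-0 m = sym (trans (gather (f m 0) (N m) (w m) (r m))
  (trans (cong (λ y → 3ℚ * (f m 0 * (N m * w m)) * y) (N*r≡1 m))
    (simplify (f m 0) (N m) (w m))))
  where
  gather : ∀ x N w r → x * (2ℚ * (N * N) * w) * (3ℚ * (½ * r)) ≡ 3ℚ * (x * (N * w)) * (N * r)
  gather = solve-∀ ℚ-ring
  simplify : ∀ x N w → 3ℚ * (x * (N * w)) * 1ℚ ≡ (2ℚ * 1ℚ + 3ℚ * N - 2ℚ) * w * x
  simplify = solve-∀ ℚ-ring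

-- Entries of the factors and induction on the product

factor-diag : ∀ m → factor (suc m) 0F 0F ≡ N m * w (suc m)
factor-diag m = trans (/-as-* (+ suc m) (2 ℕ.* (2 ℕ.* suc m ℕ.+ 1)))
  (cong (N m *_) (ℚ./-cong {+ 1} {2 ℕ.* (2 ℕ.* suc m ℕ.+ 1)} {+ 1} {2 ℕ.* suc (2 ℕ.* suc m)} refl
    (cong (2 ℕ.*_) (ℕ.+-comm (2 ℕ.* suc m) 1))))

factor-01 : ∀ m → factor (suc m) 0F 1F ≡ - 3ℚ * (r m * w (suc m))
factor-01 m = /-unique (ℤ.- + 3) (2 ℕ.* suc m ℕ.* (2 ℕ.* suc m ℕ.+ 1)) (begin
  fromℕ (2 ℕ.* suc m ℕ.* (2 ℕ.* suc m ℕ.+ 1)) * (r m * w (suc m))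
    ≡⟨ cong (_* (r m * w (suc m))) (fromℕ-* (2 ℕ.* suc m) (2 ℕ.* suc m ℕ.+ 1)) ⟩
  fromℕ (2 ℕ.* suc m) * fromℕ (2 ℕ.* suc m ℕ.+ 1) * (r m * w (suc m))
    ≡⟨ cong₂ (λ a b → a * b * (r m * w (suc m))) (fromℕ-* 2 (suc m))
         (trans (fromℕ-+ (2 ℕ.* suc m) 1) (cong (_+ 1ℚ) (fromℕ-* 2 (suc m)))) ⟩
  2ℚ * N m * (2ℚ * N m + 1ℚ) * (r m * w (suc m))
    ≡⟨ gather (N m) (r m) (w (suc m)) ⟩
  (N m * r m) * (2ℚ * (2ℚ * N m + 1ℚ) * w (suc m))
    ≡⟨ cong₂ _*_ (N*r≡1 m) ([2N+1]*w≡1 m) ⟩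
  1ℚ ∎)
  where
  open ≡-Reasoning
  gather : ∀ N r w → 2ℚ * N * (2ℚ * N + 1ℚ) * (r * w) ≡ (N * r) * (2ℚ * (2ℚ * N + 1ℚ) * w)
  gather = solve-∀ ℚ-ring

inverse-2* : ∀ k {a} → fromℕ k * a ≡ 1ℚ → fromℕ (2 ℕ.* k) * (½ * a) ≡ 1ℚ
inverse-2* k {a} ka≡1 = trans (cong (_* (½ * a)) (fromℕ-* 2 k))
  (trans (gather (fromℕ k) a) ka≡1)
  where
  gather : ∀ x a → 2ℚ * x * (½ * a) ≡ x * a
  gather = solve-∀ ℚ-ring

factor-02 : ∀ m → factor (suc m) 0F 2F ≡ 3ℚ * (½ * (r m * (r m * r m)))
factor-02 m = /-unique (+ 3) (2 ℕ.* suc m ℕ.^ 3)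
  (inverse-2* (suc m ℕ.^ 3) (inverse-pow (suc m) 2 (N*r≡1 m) (inverse-^2 m)))

factor-12 : ∀ m → factor (suc m) 1F 2F ≡ 3ℚ * (½ * r m)
factor-12 m = /-unique (+ 3) (2 ℕ.* suc m) (inverse-2* (suc m) (N*r≡1 m))

closedForm-0 : ∀ i j → identity i j ≡ closedForm 0 i j
closedForm-0 0F 0F = refl
closedForm-0 0F 1F = refl
closedForm-0 0F 2F = refl
closedForm-0 1F 0F = refl
closedForm-0 1F 1F = refl
closedForm-0 1F 2F = refl
closedForm-0 2F 0F = refl
closedForm-0 2F 1F = refl
closedForm-0 2F 2F = refl

closedForm-suc : ∀ m i j → (closedForm m ⊗ factor (suc m)) i j ≡ closedForm (suc m) i j
closedForm-suc m 0F 0F = trans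
  (drop (A m * factor (suc m) 0F 0F) (- (3ℚ * (A m * Z m))) (S₄ m))
  (trans (cong (A m *_) (factor-diag m)) (sym (A-suc m)))
  where
  drop : ∀ x y z → x + (y * 0ℚ + (z * 0ℚ + 0ℚ)) ≡ x
  drop = solve-∀ ℚ-ring
closedForm-suc m 0F 1F = begin
  A m * factor (suc m) 0F 1F + (- (3ℚ * (A m * Z m)) * factor (suc m) 1F 1F + (S₄ m * 0ℚ + 0ℚ))
    ≡⟨ cong₂ (λ b a → A m * b + (- (3ℚ * (A m * Z m)) * a + (S₄ m * 0ℚ + 0ℚ)))
         (factor-01 m) (factor-diag m) ⟩
  A m * (- 3ℚ * (r m * w′)) + (- (3ℚ * (A m * Z m)) * (N m * w′) + (S₄ m * 0ℚ + 0ℚ))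
    ≡⟨ insert (A m) (r m) w′ (Z m) (N m) (S₄ m) ⟩
  A m * (- 3ℚ * (1ℚ * r m * w′)) - 3ℚ * (A m * (N m * w′) * Z m)
    -- Replacing `r` by `N * r * r` exposes the common factor `A m * (N m * w′) = A (m+1)` and
    -- leaves `r m * r m`, the next term of `Z`.
    ≡⟨ cong (λ y → A m * (- 3ℚ * (y * r m * w′)) - 3ℚ * (A m * (N m * w′) * Z m)) (N*r≡1 m) ⟨
  A m * (- 3ℚ * (N m * r m * r m * w′)) - 3ℚ * (A m * (N m * w′) * Z m)
    ≡⟨ gather (A m) (r m) w′ (Z m) (N m) ⟩
  - (3ℚ * (A m * (N m * w′) * (Z m + r m * r m)))
    ≡⟨ cong (λ y → - (3ℚ * (y * (Z m + r m * r m)))) (A-suc m) ⟨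
  - (3ℚ * (A (suc m) * Z (suc m))) ∎
  where
  open ≡-Reasoning
  w′ = w (suc m)
  insert : ∀ A r w Z N S →
    A * (- 3ℚ * (r * w)) + (- (3ℚ * (A * Z)) * (N * w) + (S * 0ℚ + 0ℚ)) ≡
    A * (- 3ℚ * (1ℚ * r * w)) - 3ℚ * (A * (N * w) * Z)
  insert = solve-∀ ℚ-ring
  gather : ∀ A r w Z N →
    A * (- 3ℚ * (N * r * r * w)) - 3ℚ * (A * (N * w) * Z) ≡
    - (3ℚ * (A * (N * w) * (Z + r * r)))
  gather = solve-∀ ℚ-ring
closedForm-suc m 0F 2F = begin
  A m * factor (suc m) 0F 2F + (- (3ℚ * (A m * Z m)) * factor (suc m) 1F 2F + (S₄ m * 1ℚ + 0ℚ))
    ≡⟨ cong₂ (λ b a → A m * b + (- (3ℚ * (A m * Z m)) * a + (S₄ m * 1ℚ + 0ℚ)))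
         (factor-02 m) (factor-12 m) ⟩
  A m * (3ℚ * (½ * (r m * (r m * r m)))) +
    (- (3ℚ * (A m * Z m)) * (3ℚ * (½ * r m)) + (S₄ m * 1ℚ + 0ℚ))
    ≡⟨ gather (A m) (r m) (Z m) (S₄ m) ⟩
  S₄ m + A m * (3ℚ * (½ * r m)) * (r m * r m - 3ℚ * Z m)
    -- The cubic term and the `Z` term combine into `h m 0`, so the increment is the x² coefficient
    -- of `G(m,0;x)`.
    ≡⟨ cong₂ (λ a b → S₄ m + a * b) (R*f-0 m) (h-0 m) ⟨
  S₄ m + R m 0 * f m 0 * h m 0
    ≡⟨ cong (λ y → S₄ m + y) (ℚ.*-assoc (R m 0) (f m 0) (h m 0)) ⟩
  S₄ (suc m) ∎
  where
  open ≡-Reasoning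
  gather : ∀ A r Z S →
    A * (3ℚ * (½ * (r * (r * r)))) + (- (3ℚ * (A * Z)) * (3ℚ * (½ * r)) + (S * 1ℚ + 0ℚ)) ≡
    S + A * (3ℚ * (½ * r)) * (r * r - 3ℚ * Z)
  gather = solve-∀ ℚ-ring
closedForm-suc m 1F 0F = drop (factor (suc m) 0F 0F) (A m) (S₂ m)
  where
  drop : ∀ x y z → 0ℚ * x + (y * 0ℚ + (z * 0ℚ + 0ℚ)) ≡ 0ℚ
  drop = solve-∀ ℚ-ring
closedForm-suc m 1F 1F = trans
  (drop (factor (suc m) 0F 1F) (A m * factor (suc m) 1F 1F) (S₂ m))
  (trans (cong (A m *_) (factor-diag m)) (sym (A-suc m)))
  where
  drop : ∀ x y z → 0ℚ * x + (y + (z * 0ℚ + 0ℚ)) ≡ y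
  drop = solve-∀ ℚ-ring
closedForm-suc m 1F 2F = trans
  (swap (factor (suc m) 0F 2F) (A m * factor (suc m) 1F 2F) (S₂ m))
  (cong (λ y → S₂ m + y) (trans (cong (A m *_) (factor-12 m)) (sym (R*f-0 m))))
  where
  swap : ∀ x y z → 0ℚ * x + (y + (z * 1ℚ + 0ℚ)) ≡ z + y
  swap = solve-∀ ℚ-ring
closedForm-suc m 2F 0F = drop (factor (suc m) 0F 0F)
  where
  drop : ∀ x → 0ℚ * x + 0ℚ ≡ 0ℚ
  drop = solve-∀ ℚ-ring
closedForm-suc m 2F 1F = drop (factor (suc m) 0F 1F) (factor (suc m) 1F 1F)
  where
  drop : ∀ x y → 0ℚ * x + (0ℚ * y + 0ℚ) ≡ 0ℚ
  drop = solve-∀ ℚ-ring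
closedForm-suc m 2F 2F = drop (factor (suc m) 0F 2F) (factor (suc m) 1F 2F)
  where
  drop : ∀ x y → 0ℚ * x + (0ℚ * y + 1ℚ) ≡ 1ℚ
  drop = solve-∀ ℚ-ring

partialProduct≡closedForm : ∀ m i j → partialProduct factor m i j ≡ closedForm m i j
partialProduct≡closedForm zero    i j = closedForm-0 i j
partialProduct≡closedForm (suc m) i j = trans
  (sum-cong-≗ (λ k → cong (_* factor (suc m) k j) (partialProduct≡closedForm m i k)))
  (closedForm-suc m i j)

-- Bounds

+-nonneg : ∀ {p q} → 0ℚ ≤ p → 0ℚ ≤ q → 0ℚ ≤ p + q
+-nonneg = ℚ.+-mono-≤

*-mono-≤ : ∀ {p q s t} → 0ℚ ≤ s → 0ℚ ≤ q → p ≤ q → s ≤ t → p * s ≤ q * t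
*-mono-≤ {p} {q} {s} {t} 0≤s 0≤q p≤q s≤t = ℚ.≤-trans
  (ℚ.*-monoʳ-≤-nonNeg s {{nonNegative 0≤s}} p≤q)
  (ℚ.*-monoˡ-≤-nonNeg q {{nonNegative 0≤q}} s≤t)

*-nonneg : ∀ {p q} → 0ℚ ≤ p → 0ℚ ≤ q → 0ℚ ≤ p * q
*-nonneg {p} {q} 0≤p 0≤q = subst (_≤ p * q) (ℚ.*-zeroˡ q)
  (ℚ.*-monoʳ-≤-nonNeg q {{nonNegative 0≤q}} 0≤p)

≤-from-+ : ∀ {p q d} → q ≡ p + d → 0ℚ ≤ d → p ≤ q
≤-from-+ {p} {q} {d} q≡p+d 0≤d =
  subst₂ _≤_ (ℚ.+-identityʳ p) (sym q≡p+d) (ℚ.+-monoʳ-≤ p 0≤d)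

r-suc-≤ : ∀ n → r (suc n) ≤ r n
r-suc-≤ n = ≤-from-+ (recip-step n) (*-nonneg (r-nonneg n) (r-nonneg (suc n)))

r-antitone : ∀ {m n} → m ℕ.≤′ n → r n ≤ r m
r-antitone {m} ℕ.≤′-refl = ℚ.≤-refl {r m}
r-antitone {m} (ℕ.≤′-step {n} h) = ℚ.≤-trans (r-suc-≤ n) (r-antitone {m} {n} h)

r≤1 : ∀ n → r n ≤ 1ℚ
r≤1 n = r-antitone {0} {n} ℕ.z≤′n

geo : ℕ → ℚ
geo zero    = 1ℚ
geo (suc n) = ½ * geo n

0≤½ : 0ℚ ≤ ½
0≤½ = ℚ.nonNegative⁻¹ ½

geo-nonneg : ∀ n → 0ℚ ≤ geo n
geo-nonneg zero    = ℚ.nonNegative⁻¹ 1ℚ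
geo-nonneg (suc n) = *-nonneg 0≤½ (geo-nonneg n)

-- Since `1/(n+1) ≤ 2/(n+2)`, halving shrinks at least as fast as `r`. This turns geometric decay
-- into a rate `1/m`.
geo≤r : ∀ n → geo n ≤ r n
geo≤r zero    = ℚ.≤-refl
geo≤r (suc n) = begin
  ½ * geo n                              ≤⟨ ℚ.*-monoˡ-≤-nonNeg ½ (geo≤r n) ⟩
  ½ * r n                                ≡⟨ cong (½ *_) (recip-step n) ⟩
  ½ * (r (suc n) + r n * r (suc n))      ≤⟨ ℚ.*-monoˡ-≤-nonNeg ½ (ℚ.+-monoʳ-≤ (r (suc n))
                                              (ℚ.*-monoʳ-≤-nonNeg (r (suc n)) {{nonNegative (r-nonneg (suc n))}} (r≤1 n))) ⟩
  ½ * (r (suc n) + 1ℚ * r (suc n))       ≡⟨ halve (r (suc n)) ⟩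
  r (suc n)                              ∎
  where
  open ℚ.≤-Reasoning
  halve : ∀ x → ½ * (x + 1ℚ * x) ≡ x
  halve = solve-∀ ℚ-ring

∑-geo : ∀ n → ∑ n geo + 2ℚ * geo n ≡ 2ℚ
∑-geo zero    = refl
∑-geo (suc n) = trans (regroup (∑ n geo) (geo n)) (∑-geo n)
  where
  regroup : ∀ a b → a + b + 2ℚ * (½ * b) ≡ a + 2ℚ * b
  regroup = solve-∀ ℚ-ring

0≤2 : 0ℚ ≤ 2ℚ
0≤2 = ℚ.nonNegative⁻¹ 2ℚ

∑-geo≤2 : ∀ n → ∑ n geo ≤ 2ℚ
∑-geo≤2 n = ≤-from-+ (sym (∑-geo n)) (*-nonneg 0≤2 (geo-nonneg n))

-- The sum starts at 2 and never increases, because `1/(n+2)² ≤ 1/(n+1) - 1/(n+2)`.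
Z+r≤2 : ∀ n → Z (suc n) + r n ≤ 2ℚ
Z+r≤2 zero    = ℚ.≤-refl
Z+r≤2 (suc n) = begin
  Z (suc n) + r (suc n) * r (suc n) + r (suc n)   ≡⟨ swap (Z (suc n)) (r (suc n) * r (suc n)) (r (suc n)) ⟩
  Z (suc n) + (r (suc n) + r (suc n) * r (suc n)) ≤⟨ ℚ.+-monoʳ-≤ (Z (suc n)) (ℚ.+-monoʳ-≤ (r (suc n))
                                                       (ℚ.*-monoʳ-≤-nonNeg (r (suc n)) {{nonNegative (r-nonneg (suc n))}} (r-suc-≤ n))) ⟩
  Z (suc n) + (r (suc n) + r n * r (suc n))       ≡⟨ cong (λ x → Z (suc n) + x) (recip-step n) ⟨
  Z (suc n) + r n                                 ≤⟨ Z+r≤2 n ⟩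
  2ℚ                                              ∎
  where
  open ℚ.≤-Reasoning
  swap : ∀ a b c → a + b + c ≡ a + (c + b)
  swap = solve-∀ ℚ-ring

Z≤2 : ∀ n → Z n ≤ 2ℚ
Z≤2 zero    = 0≤2
Z≤2 (suc n) = ℚ.≤-trans (≤-from-+ {Z (suc n)} refl (r-nonneg n)) (Z+r≤2 n)

r²-nonneg : ∀ n → 0ℚ ≤ r n * r n
r²-nonneg n = *-nonneg (r-nonneg n) (r-nonneg n)

Z-nonneg : ∀ n → 0ℚ ≤ Z n
Z-nonneg zero    = ℚ.≤-refl
Z-nonneg (suc n) = +-nonneg (Z-nonneg n) (r²-nonneg n)

f-nonneg : ∀ n k → 0ℚ ≤ f n k
f-nonneg zero    k = r²-nonneg k
f-nonneg (suc n) k = *-nonneg (f-nonneg n k)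
  (*-nonneg (*-nonneg (*-nonneg (*-nonneg (N-nonneg n) (N-nonneg n)) (N-nonneg n)) (w-nonneg n))
    (r²-nonneg (suc (n ℕ.+ k))))

-- The ratio of consecutive values is `N³ w v²`. Over the common denominator, one half minus this
-- ratio has numerator `(2N-1)(K² + 2KN) + N²(N-1)`; writing `N = 1 + b` makes every coefficient
-- positive.
f-suc-≤ : ∀ n k → f (suc n) k ≤ ½ * f n k
f-suc-≤ n k = ≤-from-+
  (halving (f n k) (N k) (N n) b (w n) (r (suc (n ℕ.+ k))) (N≡1+ n) ([2N-1]*w≡1 n) ([N+N]*r≡1 n k))
  (*-nonneg (f-nonneg n k) (*-nonneg (*-nonneg (w-nonneg n) (r²-nonneg (suc (n ℕ.+ k))))
    (+-nonneg
      (*-nonneg (+-nonneg (ℚ.nonNegative⁻¹ 1ℚ) (*-nonneg 0≤2 0≤b))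
        (+-nonneg (*-nonneg (N-nonneg k) (N-nonneg k)) (*-nonneg 0≤2 (*-nonneg (N-nonneg k) (N-nonneg n)))))
      (*-nonneg (*-nonneg (N-nonneg n) (N-nonneg n)) 0≤b))))
  where
  b   = fromℕ n
  0≤b = fromℕ-nonneg n
  halving : ∀ x K N b w v → N ≡ 1ℚ + b → 2ℚ * (2ℚ * N - 1ℚ) * w ≡ 1ℚ → (K + N) * v ≡ 1ℚ →
    ½ * x ≡ x * (N * N * N * w * (v * v)) +
      x * (w * (v * v) * ((1ℚ + 2ℚ * b) * (K * K + 2ℚ * (K * N)) + N * N * b))
  halving x K _ b w v refl p≡1 q≡1 = trans (ones x)
    (trans (cong₂ (λ p q → ½ * x * (p * (q * q))) (sym p≡1) (sym q≡1)) (poly x K b w v))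
    where
    ones : ∀ x → ½ * x ≡ ½ * x * (1ℚ * (1ℚ * 1ℚ))
    ones = solve-∀ ℚ-ring
    poly : ∀ x K b w v →
      ½ * x * (2ℚ * (2ℚ * (1ℚ + b) - 1ℚ) * w * ((K + (1ℚ + b)) * v * ((K + (1ℚ + b)) * v))) ≡
      x * ((1ℚ + b) * (1ℚ + b) * (1ℚ + b) * w * (v * v)) +
      x * (w * (v * v) * ((1ℚ + 2ℚ * b) * (K * K + 2ℚ * (K * (1ℚ + b))) + (1ℚ + b) * (1ℚ + b) * b))
    poly = solve-∀ ℚ-ring

f≤geo : ∀ n k → f n k ≤ geo n * (r k * r k)
f≤geo zero    k = ℚ.≤-reflexive (sym (ℚ.*-identityˡ (r k * r k)))
f≤geo (suc n) k = ℚ.≤-trans (f-suc-≤ n k) (ℚ.≤-trans (ℚ.*-monoˡ-≤-nonNeg ½ (f≤geo n k))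
  (ℚ.≤-reflexive (sym (ℚ.*-assoc ½ (geo n) (r k * r k)))))

R-nonneg : ∀ n k → 0ℚ ≤ R n k
R-nonneg n k = subst (0ℚ ≤_)
  (sym (expand (N k) (N n) (fromℕ k) (fromℕ n) (w n) (N≡1+ k) (N≡1+ n)))
  (*-nonneg (+-nonneg (+-nonneg (*-nonneg 0≤2 (fromℕ-nonneg k))
    (*-nonneg (ℚ.nonNegative⁻¹ 3ℚ) (fromℕ-nonneg n))) (ℚ.nonNegative⁻¹ 3ℚ)) (w-nonneg n))
  where
  expand : ∀ K N a b w → K ≡ 1ℚ + a → N ≡ 1ℚ + b →
    (2ℚ * K + 3ℚ * N - 2ℚ) * w ≡ (2ℚ * a + 3ℚ * b + 3ℚ) * w
  expand _ _ a b w refl refl = poly a b w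
    where
    poly : ∀ a b w →
      (2ℚ * (1ℚ + a) + 3ℚ * (1ℚ + b) - 2ℚ) * w ≡ (2ℚ * a + 3ℚ * b + 3ℚ) * w
    poly = solve-∀ ℚ-ring

-- With `K = 1 + a` and `N = 1 + b`, `2K` times the denominator `2(2b+1)` exceeds the numerator of
-- `R` by `1 + 2a + 5b + 8ab`.
R≤2N : ∀ n k → R n k ≤ 2ℚ * N k
R≤2N n k = ≤-from-+
  (expand (N k) (N n) a b (w n) (N≡1+ k) (N≡1+ n) ([2N-1]*w≡1 n))
  (*-nonneg (w-nonneg n) (+-nonneg (+-nonneg (+-nonneg (ℚ.nonNegative⁻¹ 1ℚ) (*-nonneg 0≤2 0≤a))
    (*-nonneg (ℚ.nonNegative⁻¹ 5ℚ) 0≤b)) (*-nonneg (ℚ.nonNegative⁻¹ 8ℚ) (*-nonneg 0≤a 0≤b))))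
  where
  a   = fromℕ k
  b   = fromℕ n
  0≤a = fromℕ-nonneg k
  0≤b = fromℕ-nonneg n
  expand : ∀ K N a b w → K ≡ 1ℚ + a → N ≡ 1ℚ + b → 2ℚ * (2ℚ * N - 1ℚ) * w ≡ 1ℚ →
    2ℚ * K ≡ (2ℚ * K + 3ℚ * N - 2ℚ) * w +
      w * (1ℚ + 2ℚ * a + 5ℚ * b + 8ℚ * (a * b))
  expand _ _ a b w refl refl p≡1 = trans (sym (ℚ.*-identityʳ (2ℚ * (1ℚ + a))))
    (trans (cong (2ℚ * (1ℚ + a) *_) (sym p≡1)) (poly a b w))
    where
    poly : ∀ a b w → 2ℚ * (1ℚ + a) * (2ℚ * (2ℚ * (1ℚ + b) - 1ℚ) * w) ≡
      (2ℚ * (1ℚ + a) + 3ℚ * (1ℚ + b) - 2ℚ) * w +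
        w * (1ℚ + 2ℚ * a + 5ℚ * b + 8ℚ * (a * b))
    poly = solve-∀ ℚ-ring

A-nonneg : ∀ m → 0ℚ ≤ A m
A-nonneg m = *-nonneg (f-nonneg m 0)
  (*-nonneg (*-nonneg 0≤2 (*-nonneg (N-nonneg m) (N-nonneg m))) (w-nonneg m))

A≤geo : ∀ m → A m ≤ geo m
A≤geo zero    = ℚ.≤-refl
A≤geo (suc m) = begin
  A (suc m)                 ≡⟨ A-suc m ⟩
  A m * (N m * w (suc m))   ≤⟨ *-mono-≤ (*-nonneg (N-nonneg m) (w-nonneg (suc m))) (geo-nonneg m)
                                 (A≤geo m) Nw≤½ ⟩
  geo m * ½                 ≡⟨ ℚ.*-comm (geo m) ½ ⟩
  ½ * geo m                 ∎
  where
  open ℚ.≤-Reasoning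
  poly : ∀ N w → ½ * (2ℚ * (2ℚ * N + 1ℚ) * w) ≡ N * w + (N + 1ℚ) * w
  poly = solve-∀ ℚ-ring
  Nw≤½ : N m * w (suc m) ≤ ½
  Nw≤½ = ≤-from-+
    (trans (cong (½ *_) (sym ([2N+1]*w≡1 m))) (poly (N m) (w (suc m))))
    (*-nonneg (+-nonneg (N-nonneg m) (ℚ.nonNegative⁻¹ 1ℚ)) (w-nonneg (suc m)))

abs-diff-≤ : ∀ {a b} → 0ℚ ≤ a → a ≤ b → ∣ a - b ∣ ≤ b
abs-diff-≤ {a} {b} 0≤a a≤b = begin
  ∣ a - b ∣       ≡⟨ cong ∣_∣ (flip a b) ⟩
  ∣ - (b - a) ∣   ≡⟨ ℚ.∣-p∣≡∣p∣ (b - a) ⟩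
  ∣ b - a ∣       ≡⟨ ℚ.0≤p⇒∣p∣≡p (subst (_≤ b - a) (ℚ.+-inverseʳ a) (ℚ.+-monoˡ-≤ (- a) a≤b)) ⟩
  b - a           ≤⟨ ≤-from-+ (restore a b) 0≤a ⟩
  b               ∎
  where
  open ℚ.≤-Reasoning
  flip : ∀ a b → a - b ≡ - (b - a)
  flip = solve-∀ ℚ-ring
  restore : ∀ a b → b ≡ b - a + a
  restore = solve-∀ ℚ-ring

-- The start `r k * r k` is at most 1, and each increment of `h` lies between `-4/(n+1)²` and 0
-- because `v ≤ r n`. With `Z ≤ 2` this gives the constant 9.
abs-h-≤ : ∀ n k → ∣ h n k ∣ ≤ 1ℚ + 4ℚ * Z n
abs-h-≤ zero k = ℚ.≤-trans (ℚ.≤-reflexive (ℚ.0≤p⇒∣p∣≡p (r²-nonneg k)))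
  (*-mono-≤ (r-nonneg k) (ℚ.nonNegative⁻¹ 1ℚ) (r≤1 k) (r≤1 k))
abs-h-≤ (suc n) k = begin
  ∣ h n k + (v * v - 4ℚ * (r n * r n)) ∣         ≤⟨ ℚ.∣p+q∣≤∣p∣+∣q∣ (h n k) (v * v - 4ℚ * (r n * r n)) ⟩
  ∣ h n k ∣ + ∣ v * v - 4ℚ * (r n * r n) ∣       ≤⟨ ℚ.+-mono-≤ (abs-h-≤ n k)
                                                     (abs-diff-≤ (r²-nonneg (suc (n ℕ.+ k))) v²≤4r²) ⟩
  1ℚ + 4ℚ * Z n + 4ℚ * (r n * r n)               ≡⟨ collect (Z n) (r n * r n) ⟩
  1ℚ + 4ℚ * Z (suc n)                            ∎
  where
  open ℚ.≤-Reasoning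
  v = r (suc (n ℕ.+ k))
  v≤r : v ≤ r n
  v≤r = r-antitone {n} {suc (n ℕ.+ k)} (ℕ.≤⇒≤′ (ℕ.m≤n⇒m≤1+n (ℕ.m≤m+n n k)))
  four : ∀ a → 4ℚ * a ≡ a + 3ℚ * a
  four = solve-∀ ℚ-ring
  v²≤4r² : v * v ≤ 4ℚ * (r n * r n)
  v²≤4r² = ℚ.≤-trans (*-mono-≤ (r-nonneg (suc (n ℕ.+ k))) (r-nonneg n) v≤r v≤r)
    (≤-from-+ (four (r n * r n)) (*-nonneg (ℚ.nonNegative⁻¹ 3ℚ) (r²-nonneg n)))
  collect : ∀ a b → 1ℚ + 4ℚ * a + 4ℚ * b ≡ 1ℚ + 4ℚ * (a + b)
  collect = solve-∀ ℚ-ring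

abs-h-≤9 : ∀ n k → ∣ h n k ∣ ≤ 9ℚ
abs-h-≤9 n k = ℚ.≤-trans (abs-h-≤ n k) (ℚ.+-monoʳ-≤ 1ℚ (ℚ.*-monoˡ-≤-nonNeg 4ℚ (Z≤2 n)))

-- The constant 9 is chosen to match `abs-fh-≤`, so that one remainder estimate serves both
-- coefficients.
abs-f-≤ : ∀ n k → ∣ f n k ∣ ≤ 9ℚ * f n k
abs-f-≤ n k = ℚ.≤-trans (ℚ.≤-reflexive (ℚ.0≤p⇒∣p∣≡p (f-nonneg n k)))
  (≤-from-+ (nine (f n k)) (*-nonneg (ℚ.nonNegative⁻¹ 8ℚ) (f-nonneg n k)))
  where
  nine : ∀ x → 9ℚ * x ≡ x + 8ℚ * x
  nine = solve-∀ ℚ-ring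

abs-fh-≤ : ∀ n k → ∣ fh n k ∣ ≤ 9ℚ * f n k
abs-fh-≤ n k = begin
  ∣ f n k * h n k ∣       ≡⟨ ℚ.∣p*q∣≡∣p∣*∣q∣ (f n k) (h n k) ⟩
  ∣ f n k ∣ * ∣ h n k ∣   ≡⟨ cong (_* ∣ h n k ∣) (ℚ.0≤p⇒∣p∣≡p (f-nonneg n k)) ⟩
  f n k * ∣ h n k ∣       ≤⟨ ℚ.*-monoˡ-≤-nonNeg (f n k) {{nonNegative (f-nonneg n k)}} (abs-h-≤9 n k) ⟩
  f n k * 9ℚ              ≡⟨ ℚ.*-comm (f n k) 9ℚ ⟩
  9ℚ * f n k              ∎
  where open ℚ.≤-Reasoning

-- Boundary terms of the box

abs-∑-≤ : ∀ (u v : ℕ → ℚ) c → (∀ i → ∣ u i ∣ ≤ c * v i) → ∀ n → ∣ ∑ n u ∣ ≤ c * ∑ n v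
abs-∑-≤ u v c ∣u∣≤cv zero    = ℚ.≤-reflexive (sym (ℚ.*-zeroʳ c))
abs-∑-≤ u v c ∣u∣≤cv (suc n) = ℚ.≤-trans (ℚ.∣p+q∣≤∣p∣+∣q∣ (∑ n u) (u n))
  (ℚ.≤-trans (ℚ.+-mono-≤ (abs-∑-≤ u v c ∣u∣≤cv n) (∣u∣≤cv n))
    (ℚ.≤-reflexive (sym (ℚ.*-distribˡ-+ c (∑ n v) (v n)))))

-- The row `n = m` is at most `9 * geo m * Z m`, hence `18 * r m`. In the column `k = m` the bound
-- `R ≤ 2 * N m` cancels one of the two factors `r m`, and summing `18 * r m * geo n` gives
-- `36 * r m`. Together they make 54.
remainder-≤ : ∀ (F : ℕ → ℕ → ℚ) → (∀ n k → ∣ F n k ∣ ≤ 9ℚ * f n k) →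
  ∀ m → ∣ ∑ m (F m) - ∑ m (λ n → R n m * F n m) ∣ ≤ fromℕ 54 * r m
remainder-≤ F ∣F∣≤9f m = begin
  ∣ ∑ m (F m) - ∑ m (λ n → R n m * F n m) ∣
    ≤⟨ ℚ.∣p-q∣≤∣p∣+∣q∣ (∑ m (F m)) (∑ m (λ n → R n m * F n m)) ⟩
  ∣ ∑ m (F m) ∣ + ∣ ∑ m (λ n → R n m * F n m) ∣
    ≤⟨ ℚ.+-mono-≤ (abs-∑-≤ (F m) (f 0) (9ℚ * geo m) row m)
         (abs-∑-≤ (λ n → R n m * F n m) geo (2ℚ * 9ℚ * r m) column m) ⟩
  9ℚ * geo m * Z m + 2ℚ * 9ℚ * r m * ∑ m geo
    ≤⟨ ℚ.+-mono-≤
         (*-mono-≤ (Z-nonneg m) (*-nonneg 0≤9 (r-nonneg m)) (ℚ.*-monoˡ-≤-nonNeg 9ℚ (geo≤r m)) (Z≤2 m))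
         (ℚ.*-monoˡ-≤-nonNeg (2ℚ * 9ℚ * r m) {{nonNegative (*-nonneg (*-nonneg 0≤2 0≤9) (r-nonneg m))}}
           (∑-geo≤2 m)) ⟩
  9ℚ * r m * 2ℚ + 2ℚ * 9ℚ * r m * 2ℚ
    ≡⟨ collect (r m) ⟩
  fromℕ 54 * r m ∎
  where
  open ℚ.≤-Reasoning
  0≤9 : 0ℚ ≤ 9ℚ
  0≤9 = ℚ.nonNegative⁻¹ 9ℚ
  collect : ∀ x → 9ℚ * x * 2ℚ + 2ℚ * 9ℚ * x * 2ℚ ≡ + 54 / 1 * x
  collect = solve-∀ ℚ-ring
  ∣F∣≤ : ∀ n k → ∣ F n k ∣ ≤ 9ℚ * (geo n * (r k * r k))
  ∣F∣≤ n k = ℚ.≤-trans (∣F∣≤9f n k) (ℚ.*-monoˡ-≤-nonNeg 9ℚ (f≤geo n k))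
  row : ∀ k → ∣ F m k ∣ ≤ 9ℚ * geo m * (r k * r k)
  row k = ℚ.≤-trans (∣F∣≤ m k) (ℚ.≤-reflexive (sym (ℚ.*-assoc 9ℚ (geo m) (r k * r k))))
  gather : ∀ K g ρ → 2ℚ * K * (9ℚ * (g * (ρ * ρ))) ≡ 2ℚ * 9ℚ * (K * ρ) * ρ * g
  gather = solve-∀ ℚ-ring
  column : ∀ n → ∣ R n m * F n m ∣ ≤ 2ℚ * 9ℚ * r m * geo n
  column n = begin
    ∣ R n m * F n m ∣                              ≡⟨ ℚ.∣p*q∣≡∣p∣*∣q∣ (R n m) (F n m) ⟩
    ∣ R n m ∣ * ∣ F n m ∣                          ≡⟨ cong (_* ∣ F n m ∣) (ℚ.0≤p⇒∣p∣≡p (R-nonneg n m)) ⟩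
    R n m * ∣ F n m ∣                              ≤⟨ *-mono-≤ (ℚ.0≤∣p∣ (F n m)) (*-nonneg 0≤2 (N-nonneg m))
                                                        (R≤2N n m) (∣F∣≤ n m) ⟩
    2ℚ * N m * (9ℚ * (geo n * (r m * r m)))        ≡⟨ gather (N m) (geo n) (r m) ⟩
    2ℚ * 9ℚ * (N m * r m) * r m * geo n            ≡⟨ cong (λ y → 2ℚ * 9ℚ * y * r m * geo n) (N*r≡1 m) ⟩
    2ℚ * 9ℚ * r m * geo n                          ∎

-- Limits

archimedean : ∀ c ε → 0ℚ < ε → ∃[ M ] (∀ m → M ℕ.≤ m → fromℕ c * r m < ε)
-- Cross-multiplied, the goal is `c(d+1) < (p+1)(m+1)`; the witness makes `m` itself exceed
-- `c(d+1)`.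
archimedean c (mkℚ +[1+ p ] d _) _ = suc (c ℕ.* suc d) , λ m M≤m →
  subst (_< _) (/-as-* (+ c) (suc m)) (ℚ.toℚᵘ-cancel-<
    (ℚᵘ.<-respˡ-≃ (ℚᵘ.≃-sym (toℚᵘ-/ (+ c) (suc m)))
    (ℚᵘ.*<* (subst₂ ℤ._<_ (ℤ.pos-* c (suc d)) (ℤ.pos-* (suc p) (suc m))
      (ℤ.+<+ (ℕ.<-≤-trans M≤m (ℕ.≤-trans (ℕ.n≤1+n m) (ℕ.m≤m+n (suc m) (p ℕ.* suc m)))))))))
archimedean c (mkℚ +0 _ _)       (*<* (ℤ.+<+ ()))
archimedean c (mkℚ -[1+ _ ] _ _) (*<* ())

-- Comparing `a m` with the approximant of `L` at the same index is enough: the Cauchy condition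
-- carries the estimate from `seq L m` to all later `seq L n`.
⟶-from-rate : ∀ (a : ℕ → ℚ) L c → (∀ m → ∣ a m - seq L m ∣ ≤ fromℕ c * r m) → (fromℚ ∘ a) ⟶ L
⟶-from-rate a L c rate ε (δ , 0<δ , K , δ<ε) =
  -- One quarter of `δ` bounds the rate, one the Cauchy error of `L`, and one is the gap that the
  -- strict order on `ℝ` asks for; the three add up to less than `δ`.
  let (M₁ , small) = archimedean c ¼δ 0<¼δ
      (M₂ , close) = cauchy L ¼δ 0<¼δ
  in M₁ ℕ.⊔ M₂ , λ m M≤m → ¼δ , 0<¼δ , M₂ ℕ.⊔ K , λ n n≥ → begin-strict
       ∣ a m - seq L n ∣ + ¼δ
         ≡⟨ cong (λ x → ∣ x ∣ + ¼δ) (insert (a m) (seq L m) (seq L n)) ⟩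
       ∣ (a m - seq L m) + (seq L m - seq L n) ∣ + ¼δ
         ≤⟨ ℚ.+-monoˡ-≤ ¼δ (ℚ.∣p+q∣≤∣p∣+∣q∣ (a m - seq L m) (seq L m - seq L n)) ⟩
       ∣ a m - seq L m ∣ + ∣ seq L m - seq L n ∣ + ¼δ
         <⟨ ℚ.+-monoˡ-< ¼δ (ℚ.+-mono-<
              (ℚ.≤-<-trans (rate m) (small m (ℕ.m⊔n≤o⇒m≤o M₁ M₂ M≤m)))
              (close m n (ℕ.m⊔n≤o⇒n≤o M₁ M₂ M≤m) (ℕ.m⊔n≤o⇒m≤o M₂ K n≥))) ⟩
       ¼δ + ¼δ + ¼δ
         <⟨ subst (_< ¼δ + ¼δ + ¼δ + ¼δ) (ℚ.+-identityʳ (¼δ + ¼δ + ¼δ))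
              (ℚ.+-monoʳ-< (¼δ + ¼δ + ¼δ) 0<¼δ) ⟩
       ¼δ + ¼δ + ¼δ + ¼δ
         ≡⟨ quarters δ ⟩
       0ℚ + δ
         <⟨ δ<ε n (ℕ.m⊔n≤o⇒n≤o M₂ K n≥) ⟩
       seq ε n ∎
  where
  open ℚ.≤-Reasoning
  ¼δ = + 1 / 4 * δ
  0<¼δ : 0ℚ < ¼δ
  0<¼δ = subst (_< ¼δ) (ℚ.*-zeroʳ (+ 1 / 4)) (ℚ.*-monoʳ-<-pos (+ 1 / 4) 0<δ)
  insert : ∀ a b c → a - c ≡ (a - b) + (b - c)
  insert = solve-∀ ℚ-ring
  quarters : ∀ x → + 1 / 4 * x + + 1 / 4 * x + + 1 / 4 * x + + 1 / 4 * x ≡ 0ℚ + x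
  quarters = solve-∀ ℚ-ring

-- Rates of convergence of the entries

A-rate : ∀ m → ∣ A m - 0ℚ ∣ ≤ fromℕ 1 * r m
A-rate m = begin
  ∣ A m - 0ℚ ∣   ≡⟨ cong ∣_∣ (ℚ.+-identityʳ (A m)) ⟩
  ∣ A m ∣        ≡⟨ ℚ.0≤p⇒∣p∣≡p (A-nonneg m) ⟩
  A m            ≤⟨ ℚ.≤-trans (A≤geo m) (geo≤r m) ⟩
  r m            ≡⟨ ℚ.*-identityˡ (r m) ⟨
  fromℕ 1 * r m  ∎
  where open ℚ.≤-Reasoning

AZ-rate : ∀ m → ∣ - (3ℚ * (A m * Z m)) - 0ℚ ∣ ≤ fromℕ 6 * r m
AZ-rate m = begin
  ∣ - (3ℚ * (A m * Z m)) - 0ℚ ∣  ≡⟨ cong ∣_∣ (ℚ.+-identityʳ (- (3ℚ * (A m * Z m)))) ⟩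
  ∣ - (3ℚ * (A m * Z m)) ∣       ≡⟨ ℚ.∣-p∣≡∣p∣ (3ℚ * (A m * Z m)) ⟩
  ∣ 3ℚ * (A m * Z m) ∣           ≡⟨ ℚ.0≤p⇒∣p∣≡p (*-nonneg (ℚ.nonNegative⁻¹ 3ℚ)
                                      (*-nonneg (A-nonneg m) (Z-nonneg m))) ⟩
  3ℚ * (A m * Z m)               ≤⟨ ℚ.*-monoˡ-≤-nonNeg 3ℚ (*-mono-≤ (Z-nonneg m) (r-nonneg m)
                                      (ℚ.≤-trans (A≤geo m) (geo≤r m)) (Z≤2 m)) ⟩
  3ℚ * (r m * 2ℚ)                ≡⟨ six (r m) ⟩
  fromℕ 6 * r m                  ∎
  where
  open ℚ.≤-Reasoning
  six : ∀ x → 3ℚ * (x * 2ℚ) ≡ + 6 / 1 * x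
  six = solve-∀ ℚ-ring

∑-rate : ∀ (F : ℕ → ℕ → ℚ) →
  (∀ n k → F n k - F (suc n) k ≡ R n k * F n k - R n (suc k) * F n (suc k)) →
  (∀ n k → ∣ F n k ∣ ≤ 9ℚ * f n k) →
  ∀ m → ∣ ∑ m (λ n → R n 0 * F n 0) - ∑ m (F 0) ∣ ≤ fromℕ 54 * r m
∑-rate F FG ∣F∣≤9f m = begin
  ∣ S - T ∣       ≡⟨ cong ∣_∣ (flip S T) ⟩
  ∣ - (T - S) ∣   ≡⟨ ℚ.∣-p∣≡∣p∣ (T - S) ⟩
  -- The box is taken square, so that `T` is the partial sum of the zeta series with the same number
  -- of terms as `S`.
  ∣ T - S ∣       ≡⟨ cong ∣_∣ (telescope F (λ n k → R n k * F n k) FG m m) ⟩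
  ∣ ∑ m (F m) - ∑ m (λ n → R n m * F n m) ∣ ≤⟨ remainder-≤ F ∣F∣≤9f m ⟩
  fromℕ 54 * r m  ∎
  where
  open ℚ.≤-Reasoning
  S = ∑ m (λ n → R n 0 * F n 0)
  T = ∑ m (F 0)
  flip : ∀ a b → a - b ≡ - (b - a)
  flip = solve-∀ ℚ-ring

exact-rate : ∀ q m → ∣ q - q ∣ ≤ fromℕ 0 * r m
exact-rate q m = ℚ.≤-reflexive (trans (cong ∣_∣ (ℚ.+-inverseʳ q)) (sym (ℚ.*-zeroˡ (r m))))

entry-⟶ : ∀ i j L c → (∀ m → ∣ closedForm m i j - seq L m ∣ ≤ fromℕ c * r m) →
  (λ m → fromℚ (partialProduct factor m i j)) ⟶ L
entry-⟶ i j L c rate = ⟶-from-rate (λ m → partialProduct factor m i j) L c λ m →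
  subst (λ x → ∣ x - seq L m ∣ ≤ fromℕ c * r m) (sym (partialProduct≡closedForm m i j)) (rate m)

theorem6p2 : InfiniteProduct factor limitMatrix
theorem6p2 0F 0F = entry-⟶ 0F 0F 0ℝ 1 A-rate
theorem6p2 0F 1F = entry-⟶ 0F 1F 0ℝ 6 AZ-rate
theorem6p2 0F 2F = entry-⟶ 0F 2F (ζ 4) 54 λ m →
  subst (λ x → ∣ S₄ m - x ∣ ≤ fromℕ 54 * r m) (sym (zetaSum-4 m)) (∑-rate fh fh-telescopes abs-fh-≤ m)
theorem6p2 1F 0F = entry-⟶ 1F 0F 0ℝ 0 (exact-rate 0ℚ)
theorem6p2 1F 1F = entry-⟶ 1F 1F 0ℝ 1 A-rate
theorem6p2 1F 2F = entry-⟶ 1F 2F (ζ 2) 54 λ m →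
  subst (λ x → ∣ S₂ m - x ∣ ≤ fromℕ 54 * r m) (sym (zetaSum-2 m)) (∑-rate f f-telescopes abs-f-≤ m)
theorem6p2 2F 0F = entry-⟶ 2F 0F 0ℝ 0 (exact-rate 0ℚ)
theorem6p2 2F 1F = entry-⟶ 2F 1F 0ℝ 0 (exact-rate 0ℚ)
theorem6p2 2F 2F = entry-⟶ 2F 2F 1ℝ 0 (exact-rate 1ℚ)
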